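{- There is no $CW(60,36)$.
   Context: $C_v$ is the cyclic group of order $v$. A $CW(v,n)$ is an element $D=\sum_ga_gg\in\mathbb{Z}[C_v]$ with all $a_g\in\{0,\pm1\}$ and $DD^{(-1)}=n$, where $D^{(-1)}=\sum_ga_gg^{ -1}$; equivalently, a $v\times v$ circulant matrix $M$ with entries in $\{0,\pm1\}$ and $MM^T=nI$. -}

module Defs where

open import Data.Nat using (ℕ; zero; suc; NonZero)
open import Data.Nat.DivMod using (_mod_)
open import Data.Fin using (Fin; toℕ)
open import Data.Integer using (ℤ; +_; -[1+_]; _*_; _+_)
open import Data.Product using (_×_; Σ)
open import Data.Sum using (_⊎_)
open import Relation.Binary.PropositionalEquality using (_≡_)

-- An element D = Σ_g a_g g of ℤ[C_v], C_v = ℤ/vℤ written additively as Fin v,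
-- given by its coefficient function.
-- Coefficients in {0, ±1}.
Ternary : ℤ → Set
Ternary x = (x ≡ + 0) ⊎ ((x ≡ + 1) ⊎ (x ≡ -[1+ 0 ]))

sumTo : ℕ → (ℕ → ℤ) → ℤ
sumTo zero    f = + 0
sumTo (suc n) f = sumTo n f + f n

-- coefficient of the group element k in D D^(-1):
--   (D D^(-1))_k = Σ_g a_{g+k} a_g    (indices mod v)
coeffDDinv : (v : ℕ) .{{_ : NonZero v}} → (Fin v → ℤ) → Fin v → ℤ
coeffDDinv v a k = sumTo v (λ g → a ((g Data.Nat.+ toℕ k) mod v) * a (g mod v))

-- the identity element of C_v is 0; D D^(-1) = n (n times the identity)
IsCW : (v n : ℕ) .{{_ : NonZero v}} → (Fin v → ℤ) → Set
IsCW v n a =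
  ((g : Fin v) → Ternary (a g)) ×
  ((k : Fin v) → coeffDDinv v a k ≡ (if0 k))
  where
    if0 : Fin v → ℤ
    if0 Fin.zero    = + n
    if0 (Fin.suc _) = + 0

CWExists : (v n : ℕ) .{{_ : NonZero v}} → Set
CWExists v n = Σ (Fin v → ℤ) (IsCW v n)

{-# OPTIONS --safe #-}

-- Split C₆₀ into the ten cosets of its subgroup of order 6.  The images f and
-- c of D under g¹⁰ ↦ 1 and g¹⁰ ↦ -1 and the image b of D in ℤ[C₃₀] all have
-- norm 36.  Since 3 is self-conjugate modulo 10 and 2 modulo 5, 3 divides f,
-- 2 divides c, and b is constant modulo 3 on the cosets of C₃.  As f ≡ c
-- modulo 2 and |f| ≤ 6, the sum of squares 36 forces f = ±6 on one coset, on
-- which D is constant, and f = 0 on the others, each of which is left with 51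
-- possibilities.  These are excluded by backtracking: characters χ of
-- order 20, 30 and 60 with values in ℤ/p satisfy χ(D) χ⁻¹(D) = 36; the first
-- determines c up to 22 possibilities, the second then restricts b, and no
-- choice passes the third.
module Submission where

open import Defs
open import Relation.Nullary using (¬_)
open import Data.Nat using (NonZero)

open import Data.Bool using (Bool; true; false; if_then_else_; T)
import Data.Bool.Properties as Bool
open import Data.Fin as Fin using (Fin; toℕ; fromℕ<)
import Data.Fin.Properties as Fin
open import Data.Integer using (ℤ; +_; -[1+_]; 0ℤ; 1ℤ; -1ℤ; _+_; _*_; _-_; -_; _^_; ∣_∣; _≤_; _≤?_)
open import Data.Integer.DivMod using (_%ℕ_; _/ℕ_; a≡a%ℕn+[a/ℕn]*n; n%ℕd<d)
open import Data.Integer.Divisibility.Signed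
open import Data.Integer.Properties
open import Data.Integer.Tactic.RingSolver using (solve-∀)
open import Data.List using
  ( List; []; _∷_; _++_; _ʳ++_; reverse; map; filter; deduplicate; drop; replicate; upTo
  ; applyUpTo; cartesianProduct; cartesianProductWith )
open import Data.List.Membership.DecPropositional _≟_ using (_∈?_)
open import Data.List.Membership.Propositional using (_∈_; find)
open import Data.List.Membership.Propositional.Properties
open import Data.List.Properties using (map-applyUpTo)
open import Data.List.Relation.Binary.Pointwise as Pointwise using (Pointwise; []; _∷_)
open import Data.List.Relation.Unary.All as All using (All; all?)
open import Data.List.Relation.Unary.Any using (Any; any?; here; there)
open import Data.Nat as ℕ using (ℕ; zero; suc; z<s; s<s)
import Data.Nat.Divisibility as ℕ
import Data.Nat.DivMod as ℕ
import Data.Nat.Properties as ℕ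
import Data.Nat.Tactic.RingSolver as ℕ using (solve-∀)
open import Data.Product using (_×_; _,_; proj₁; proj₂; ∃-syntax)
import Data.Product.Properties as Product
open import Data.Sum using (_⊎_; inj₁; inj₂)
open import Function using (_∘_; id; Equivalence)
open import Relation.Binary using (DecidableEquality)
open import Relation.Nullary using (Dec; yes; no; does; contradiction; ¬?; _×-dec_; _⊎-dec_; _→-dec_)
open import Relation.Nullary.Decidable using (map′; toWitness)
open import Relation.Binary.PropositionalEquality

-- Self-conjugacy here means that -1 is a power of the prime: 3² ≡ -1 mod 10 and 2² ≡ -1 mod 5.
-- Conjugation is then a power of Frobenius, so that F F* = 0 in characteristic 3 or 2 forces F to
-- vanish at the roots of unity concerned. Only finitely many residue sequences occur, so the code
-- verifies these consequences by enumeration and needs no finite field. The orders 20, 30 and 60 of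
-- the characters are chosen by what they see. If χ has order 20 then χ(g¹⁰) = -1 and χ(D) depends
-- only on c; if it has order 30 then χ(g³⁰) = 1 and χ(D) depends only on b. So each search decides
-- a coarse image of D before the cosets are resolved further. As p ≡ 1 mod 60, characters of all
-- three orders exist modulo p. Of the 22 sequences c, the 18 with a single entry ±6 are trivial.
-- Half of each of the other four is the first row of a negacyclic conference matrix of order 10.

-- Congruences and finite sums

-- For M = 0 this is equality, so that exact identities and congruences
-- can share their proofs.
record _≈_[_] (x y M : ℤ) : Set where
  constructor divisible
  field difference : M ∣ x - y

open _≈_[_]

infix 4 _≈_[_]

module _ {M : ℤ} where

  ≈-reflexive : ∀ {x y} → x ≡ y → x ≈ y [ M ]
  ≈-reflexive {x} refl = divisible (subst (M ∣_) (sym (+-inverseʳ x)) (divides 0ℤ refl))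

  ≈-refl : ∀ {x} → x ≈ x [ M ]
  ≈-refl = ≈-reflexive refl

  ≈-sym : ∀ {x y} → x ≈ y [ M ] → y ≈ x [ M ]
  ≈-sym {x} {y} (divisible d) = divisible (subst (M ∣_) (identity x y) (∣m⇒∣-m d))
    where
    identity : ∀ x y → - (x - y) ≡ y - x
    identity = solve-∀

  ≈-trans : ∀ {x y z} → x ≈ y [ M ] → y ≈ z [ M ] → x ≈ z [ M ]
  ≈-trans {x} {y} {z} (divisible d) (divisible e) =
    divisible (subst (M ∣_) (identity x y z) (∣m∣n⇒∣m+n d e))
    where
    identity : ∀ x y z → (x - y) + (y - z) ≡ x - z
    identity = solve-∀

  +-cong-≈ : ∀ {w x y z} → w ≈ x [ M ] → y ≈ z [ M ] → w + y ≈ x + z [ M ]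
  +-cong-≈ {w} {x} {y} {z} (divisible d) (divisible e) =
    divisible (subst (M ∣_) (identity w x y z) (∣m∣n⇒∣m+n d e))
    where
    identity : ∀ w x y z → (w - x) + (y - z) ≡ (w + y) - (x + z)
    identity = solve-∀

  *-cong-≈ : ∀ {w x y z} → w ≈ x [ M ] → y ≈ z [ M ] → w * y ≈ x * z [ M ]
  *-cong-≈ {w} {x} {y} {z} (divisible d) (divisible e) =
    divisible (subst (M ∣_) (identity w x y z) (∣m∣n⇒∣m+n (∣m⇒∣m*n y d) (∣n⇒∣m*n x e)))
    where
    identity : ∀ w x y z → (w - x) * y + x * (y - z) ≡ w * y - x * z
    identity = solve-∀

  *-congˡ-≈ : ∀ z {x y} → x ≈ y [ M ] → z * x ≈ z * y [ M ]
  *-congˡ-≈ z {x} {y} = *-cong-≈ {z} {z} {x} {y} ≈-refl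

  *-congʳ-≈ : ∀ z {x y} → x ≈ y [ M ] → x * z ≈ y * z [ M ]
  *-congʳ-≈ z {x} {y} x≈y = *-cong-≈ {x} {y} {z} {z} x≈y ≈-refl

  ∣⇒≈0 : ∀ {x} → M ∣ x → x ≈ 0ℤ [ M ]
  ∣⇒≈0 {x} d = divisible (subst (M ∣_) (sym (+-identityʳ x)) d)

  ≈0⇒∣ : ∀ {x} → x ≈ 0ℤ [ M ] → M ∣ x
  ≈0⇒∣ {x} (divisible d) = subst (M ∣_) (+-identityʳ x) d

≈⇒≡ : ∀ {x y} → x ≈ y [ 0ℤ ] → x ≡ y
≈⇒≡ {x} {y} (divisible d) = i-j≡0⇒i≡j x y (0∣⇒≡0 d)

sum-cong-≈ : ∀ {M} n {f g} → (∀ i → i ℕ.< n → f i ≈ g i [ M ]) → sumTo n f ≈ sumTo n g [ M ]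
sum-cong-≈ zero    h = ≈-refl
sum-cong-≈ (suc n) h = +-cong-≈ (sum-cong-≈ n (λ i i<n → h i (ℕ.m<n⇒m<1+n i<n))) (h n ℕ.≤-refl)

sum-cong : ∀ n {f g} → (∀ i → i ℕ.< n → f i ≡ g i) → sumTo n f ≡ sumTo n g
sum-cong zero    h = refl
sum-cong (suc n) h = cong₂ _+_ (sum-cong n (λ i i<n → h i (ℕ.m<n⇒m<1+n i<n))) (h n ℕ.≤-refl)

sum-zero : ∀ n → sumTo n (λ _ → 0ℤ) ≡ 0ℤ
sum-zero zero    = refl
sum-zero (suc n) = trans (+-identityʳ (sumTo n _)) (sum-zero n)

sum-+ : ∀ n f g → sumTo n (λ i → f i + g i) ≡ sumTo n f + sumTo n g
sum-+ zero    f g = refl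
sum-+ (suc n) f g = trans (cong (_+ (f n + g n)) (sum-+ n f g)) (identity (sumTo n f) (sumTo n g) (f n) (g n))
  where
  identity : ∀ a b c d → (a + b) + (c + d) ≡ (a + c) + (b + d)
  identity = solve-∀

sum-*ˡ : ∀ n c f → sumTo n (λ i → c * f i) ≡ c * sumTo n f
sum-*ˡ zero    c f = sym (*-zeroʳ c)
sum-*ˡ (suc n) c f = trans (cong (_+ c * f n) (sum-*ˡ n c f)) (sym (*-distribˡ-+ c (sumTo n f) (f n)))

sum-swap : ∀ m n (f : ℕ → ℕ → ℤ) →
           sumTo m (λ i → sumTo n (λ j → f i j)) ≡ sumTo n (λ j → sumTo m (λ i → f i j))
sum-swap zero    n f = sym (sum-zero n)
sum-swap (suc m) n f = trans (cong (_+ sumTo n (f m)) (sum-swap m n f)) (sym (sum-+ n _ (f m)))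

sum-first : ∀ n f → sumTo (suc n) f ≡ f 0 + sumTo n (f ∘ suc)
sum-first zero    f = +-comm 0ℤ (f 0)
sum-first (suc n) f = trans (cong (_+ f (suc n)) (sum-first n f)) (+-assoc (f 0) (sumTo n (f ∘ suc)) (f (suc n)))

sum-append : ∀ m n f → sumTo (m ℕ.+ n) f ≡ sumTo m f + sumTo n (λ i → f (m ℕ.+ i))
sum-append m zero    f rewrite ℕ.+-identityʳ m = sym (+-identityʳ (sumTo m f))
sum-append m (suc n) f rewrite ℕ.+-suc m n     =
  trans (cong (_+ f (m ℕ.+ n)) (sum-append m n f)) (+-assoc (sumTo m f) _ (f (m ℕ.+ n)))

sum-blocks : ∀ q r f → sumTo (q ℕ.* r) f ≡ sumTo r (λ x → sumTo q (λ m → f (x ℕ.+ r ℕ.* m)))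
sum-blocks zero    r f = sym (sum-zero r)
sum-blocks (suc q) r f = begin
  sumTo (r ℕ.+ q ℕ.* r) f
    ≡⟨ cong (λ n → sumTo n f) (ℕ.+-comm r (q ℕ.* r)) ⟩
  sumTo (q ℕ.* r ℕ.+ r) f
    ≡⟨ sum-append (q ℕ.* r) r f ⟩
  sumTo (q ℕ.* r) f + sumTo r (λ x → f (q ℕ.* r ℕ.+ x))
    ≡⟨ cong₂ _+_ (sum-blocks q r f)
         (sum-cong r λ x _ → cong f (trans (ℕ.+-comm (q ℕ.* r) x) (cong (x ℕ.+_) (ℕ.*-comm q r)))) ⟩
  sumTo r (λ x → sumTo q (λ m → f (x ℕ.+ r ℕ.* m))) + sumTo r (λ x → f (x ℕ.+ r ℕ.* q))
    ≡⟨ sum-+ r _ (λ x → f (x ℕ.+ r ℕ.* q)) ⟨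
  sumTo r (λ x → sumTo (suc q) (λ m → f (x ℕ.+ r ℕ.* m))) ∎
  where open ≡-Reasoning

-- Advancing the window by one place trades `f h` for `f (h + n)`, which is congruent to it.
sum-shift : ∀ {M} n f → (∀ i → f (i ℕ.+ n) ≈ f i [ M ]) →
            ∀ h → sumTo n (λ i → f (i ℕ.+ h)) ≈ sumTo n f [ M ]
sum-shift         n f periodic zero    = ≈-reflexive (sum-cong n λ i _ → cong f (ℕ.+-identityʳ i))
sum-shift {M = M} n f periodic (suc h) =
  ≈-trans (divisible (subst (M ∣_) telescope (difference (periodic h)))) (sum-shift n f periodic h)
  where
  open ≡-Reasoning
  S = sumTo n (λ i → f (i ℕ.+ h))
  S′ = sumTo n (λ i → f (i ℕ.+ suc h))

  both : f h + S′ ≡ S + f (h ℕ.+ n)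
  both = begin
    f h + S′                                ≡⟨ cong (λ z → f h + z) (sum-cong n λ i _ → cong f (ℕ.+-suc i h)) ⟩
    f h + sumTo n (λ i → f (suc i ℕ.+ h))   ≡⟨ sum-first n (λ i → f (i ℕ.+ h)) ⟨
    sumTo (suc n) (λ i → f (i ℕ.+ h))       ≡⟨ cong (λ j → S + f j) (ℕ.+-comm n h) ⟩
    S + f (h ℕ.+ n)                         ∎

  telescope : f (h ℕ.+ n) - f h ≡ S′ - S
  telescope = begin
    f (h ℕ.+ n) - f h              ≡⟨ add-cancel (f (h ℕ.+ n)) (f h) S ⟩
    (S + f (h ℕ.+ n)) - (f h + S)  ≡⟨ cong (_- (f h + S)) both ⟨
    (f h + S′) - (f h + S)         ≡⟨ cancel (f h) S′ S ⟩
    S′ - S                         ∎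
    where
    add-cancel : ∀ a b c → a - b ≡ (c + a) - (b + c)
    add-cancel = solve-∀
    cancel : ∀ a b c → (a + b) - (a + c) ≡ b - c
    cancel = solve-∀

-- Correlations

δ : ℤ → ℕ → ℤ
δ n zero    = n
δ n (suc _) = 0ℤ

record CW (v : ℕ) (n : ℤ) (α : ℕ → ℤ) : Set where
  field
    ternary     : ∀ g → Ternary (α g)
    periodic    : ∀ g → α (g ℕ.+ v) ≡ α g
    correlation : ∀ k → k ℕ.< v → sumTo v (λ g → α (g ℕ.+ k) * α g) ≡ δ n k

fromIsCW : ∀ {v n a} .{{_ : NonZero v}} → IsCW v n a → CW v (+ n) (λ g → a (g ℕ.mod v))
fromIsCW {v} {n} {a} (ternary , correlations) = record
  { ternary     = λ g → ternary (g ℕ.mod v)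
  ; periodic    = λ g → cong a (Fin.fromℕ<-cong _ _ (ℕ.[m+n]%n≡m%n g v) _ _)
  ; correlation = λ k k<v →
      subst (λ j → sumTo v (λ g → a ((g ℕ.+ j) ℕ.mod v) * a (g ℕ.mod v)) ≡ δ (+ n) j)
            (Fin.toℕ-fromℕ< k<v) (coefficient (fromℕ< k<v))
  }
  where
  coefficient : ∀ k → coeffDDinv v a k ≡ δ (+ n) (toℕ k)
  coefficient k with k | correlations k
  ... | Fin.zero  | eq = eq
  ... | Fin.suc _ | eq = eq

+-swap : ∀ x y z → x ℕ.+ y ℕ.+ z ≡ x ℕ.+ z ℕ.+ y
+-swap x y z = trans (ℕ.+-assoc x y z) (trans (cong (x ℕ.+_) (ℕ.+-comm y z)) (sym (ℕ.+-assoc x z y)))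

shift : ∀ {v n α} → CW v n α → ∀ h → CW v n (λ g → α (g ℕ.+ h))
shift {v} {n} {α} D h = record
  { ternary     = λ g → ternary (g ℕ.+ h)
  ; periodic    = λ g → trans (cong α (+-swap g v h)) (periodic (g ℕ.+ h))
  ; correlation = λ k k<v → trans (shifted k) (correlation k k<v)
  }
  where
  open CW D
  product : ℕ → ℕ → ℤ
  product k g = α (g ℕ.+ k) * α g

  product-periodic : ∀ k g → product k (g ℕ.+ v) ≡ product k g
  product-periodic k g = cong₂ _*_ (trans (cong α (+-swap g v k)) (periodic (g ℕ.+ k))) (periodic g)

  shifted : ∀ k → sumTo v (λ g → α (g ℕ.+ k ℕ.+ h) * α (g ℕ.+ h)) ≡ sumTo v (product k)
  shifted k = trans (sum-cong v λ g _ → cong (λ j → α j * α (g ℕ.+ h)) (+-swap g k h))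
                    (≈⇒≡ (sum-shift v (product k) (λ g → ≈-reflexive (product-periodic k g)) h))

scale : ∀ {v n α σ} → σ ∈ 1ℤ ∷ -1ℤ ∷ [] → CW v n α → CW v n (λ g → σ * α g)
scale {v} {n} {α} {σ} σ∈ D = record
  { ternary     = λ g → scale-ternary σ∈ (ternary g)
  ; periodic    = λ g → cong (λ z → σ * z) (periodic g)
  ; correlation = λ k k<v → trans
      (sum-cong v λ g _ → trans (regroup σ (α (g ℕ.+ k)) (α g))
                                (trans (cong (_* (α (g ℕ.+ k) * α g)) (σ²≡1 σ∈)) (*-identityˡ (α (g ℕ.+ k) * α g))))
      (correlation k k<v)
  }
  where
  open CW D
  scale-ternary : ∀ {σ a} → σ ∈ 1ℤ ∷ -1ℤ ∷ [] → Ternary a → Ternary (σ * a)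
  scale-ternary (here refl)         (inj₁ refl)        = inj₁ refl
  scale-ternary (here refl)         (inj₂ (inj₁ refl)) = inj₂ (inj₁ refl)
  scale-ternary (here refl)         (inj₂ (inj₂ refl)) = inj₂ (inj₂ refl)
  scale-ternary (there (here refl)) (inj₁ refl)        = inj₁ refl
  scale-ternary (there (here refl)) (inj₂ (inj₁ refl)) = inj₂ (inj₂ refl)
  scale-ternary (there (here refl)) (inj₂ (inj₂ refl)) = inj₂ (inj₁ refl)

  σ²≡1 : ∀ {σ} → σ ∈ 1ℤ ∷ -1ℤ ∷ [] → σ * σ ≡ 1ℤ
  σ²≡1 (here refl)         = refl
  σ²≡1 (there (here refl)) = refl

  regroup : ∀ σ a b → (σ * a) * (σ * b) ≡ (σ * σ) * (a * b)
  regroup = solve-∀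

-- For q r = v this is the coefficient of g in the image of D under the map
-- that sends the r-th power of the generator to σ⁻¹.
foldBy : (q r : ℕ) → ℤ → (ℕ → ℤ) → ℕ → ℤ
foldBy q r σ α g = sumTo q (λ m → σ ^ m * α (g ℕ.+ r ℕ.* m))

module Projection {v n α} (D : CW v n α) (M : ℤ)
                  (q r : ℕ) .{{_ : NonZero q}} .{{_ : NonZero r}} (qr≡v : q ℕ.* r ≡ v)
                  (σ τ : ℤ) (στ≈1 : σ * τ ≈ 1ℤ [ M ]) (σ^q≈1 : σ ^ q ≈ 1ℤ [ M ]) where

  open CW D

  β : ℕ → ℤ
  β = foldBy q r σ α

  -- Multiplying `β (g + r)` by `σ` advances the summation index by one. The summand has period `q`,
  -- since `σ ^ q ≈ 1` and `q r = v`, so the sum becomes `β g`; then `τ` cancels `σ`.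
  step : ∀ g → β (g ℕ.+ r) ≈ τ * β g [ M ]
  step g = ≈-trans (≈-reflexive (sym (*-identityˡ (β (g ℕ.+ r)))))
          (≈-trans (*-congʳ-≈ (β (g ℕ.+ r)) (≈-sym (≈-trans (≈-reflexive (*-comm τ σ)) στ≈1)))
          (≈-trans (≈-reflexive (*-assoc τ σ (β (g ℕ.+ r))))
                   (*-congˡ-≈ τ σβ)))
    where
    f : ℕ → ℤ
    f m = σ ^ m * α (g ℕ.+ r ℕ.* m)

    index : ∀ i → g ℕ.+ r ℕ.* (i ℕ.+ q) ≡ (g ℕ.+ r ℕ.* i) ℕ.+ v
    index i = trans (cong (g ℕ.+_) (trans (ℕ.*-distribˡ-+ r i q)
                (cong (r ℕ.* i ℕ.+_) (trans (ℕ.*-comm r q) qr≡v)))) (sym (ℕ.+-assoc g (r ℕ.* i) v))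

    power : ∀ i → σ ^ (i ℕ.+ q) ≈ σ ^ i [ M ]
    power i = ≈-trans (≈-reflexive (^-distribˡ-+-* σ i q))
             (≈-trans (*-congˡ-≈ (σ ^ i) σ^q≈1) (≈-reflexive (*-identityʳ (σ ^ i))))

    f-periodic : ∀ i → f (i ℕ.+ q) ≈ f i [ M ]
    f-periodic i = *-cong-≈ (power i) (≈-reflexive (trans (cong α (index i)) (periodic _)))

    term : ∀ m → σ * (σ ^ m * α (g ℕ.+ r ℕ.+ r ℕ.* m)) ≡ f (m ℕ.+ 1)
    term m rewrite ℕ.+-comm m 1 =
      trans (sym (*-assoc σ (σ ^ m) _))
            (cong (λ j → σ * σ ^ m * α j) (trans (ℕ.+-assoc g r _) (cong (g ℕ.+_) (sym (ℕ.*-suc r m)))))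

    σβ : σ * β (g ℕ.+ r) ≈ β g [ M ]
    σβ = ≈-trans (≈-reflexive (trans (sym (sum-*ˡ q σ _)) (sum-cong q λ m _ → term m)))
                 (sum-shift q f f-periodic 1)

  steps : ∀ m g → β (g ℕ.+ r ℕ.* m) ≈ τ ^ m * β g [ M ]
  steps zero    g = ≈-reflexive (trans (cong β (trans (cong (g ℕ.+_) (ℕ.*-zeroʳ r)) (ℕ.+-identityʳ g)))
                                       (sym (*-identityˡ (β g))))
  steps (suc m) g =
    ≈-trans (≈-reflexive (cong β index))
   (≈-trans (step (g ℕ.+ r ℕ.* m))
   (≈-trans (*-congˡ-≈ τ (steps m g)) (≈-reflexive (sym (*-assoc τ (τ ^ m) (β g))))))
    where
    index : g ℕ.+ r ℕ.* suc m ≡ g ℕ.+ r ℕ.* m ℕ.+ r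
    index = trans (cong (g ℕ.+_) (trans (ℕ.*-suc r m) (ℕ.+-comm r _))) (sym (ℕ.+-assoc g _ r))

  coefficient : ℕ → ℤ
  coefficient j = sumTo v (λ g → α (g ℕ.+ j) * α g)

  regroup : ∀ k → sumTo q (λ m → σ ^ m * coefficient (k ℕ.+ r ℕ.* m)) ≡
                  sumTo r (λ x → sumTo q (λ m → β (x ℕ.+ r ℕ.* m ℕ.+ k) * α (x ℕ.+ r ℕ.* m)))
  regroup k = begin
    sumTo q (λ m → σ ^ m * coefficient (k ℕ.+ r ℕ.* m))
      ≡⟨ sum-cong q (λ m _ → sym (sum-*ˡ v (σ ^ m) _)) ⟩
    sumTo q (λ m → sumTo v (λ g → σ ^ m * (α (g ℕ.+ (k ℕ.+ r ℕ.* m)) * α g)))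
      ≡⟨ sum-swap q v (λ m g → σ ^ m * (α (g ℕ.+ (k ℕ.+ r ℕ.* m)) * α g)) ⟩
    sumTo v (λ g → sumTo q (λ m → σ ^ m * (α (g ℕ.+ (k ℕ.+ r ℕ.* m)) * α g)))
      ≡⟨ sum-cong v (λ g _ → factor g) ⟩
    sumTo v (λ g → β (g ℕ.+ k) * α g)
      ≡⟨ cong (λ n → sumTo n (λ g → β (g ℕ.+ k) * α g)) (sym qr≡v) ⟩
    sumTo (q ℕ.* r) (λ g → β (g ℕ.+ k) * α g)
      ≡⟨ sum-blocks q r (λ g → β (g ℕ.+ k) * α g) ⟩
    sumTo r (λ x → sumTo q (λ m → β (x ℕ.+ r ℕ.* m ℕ.+ k) * α (x ℕ.+ r ℕ.* m))) ∎
    where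
    open ≡-Reasoning
    rotate : ∀ a b c → a * (b * c) ≡ c * (a * b)
    rotate = solve-∀

    factor : ∀ g → sumTo q (λ m → σ ^ m * (α (g ℕ.+ (k ℕ.+ r ℕ.* m)) * α g)) ≡ β (g ℕ.+ k) * α g
    factor g = begin
      sumTo q (λ m → σ ^ m * (α (g ℕ.+ (k ℕ.+ r ℕ.* m)) * α g))
        ≡⟨ sum-cong q (λ m _ → trans (cong (λ j → σ ^ m * (α j * α g)) (sym (ℕ.+-assoc g k _)))
                                     (rotate (σ ^ m) _ (α g))) ⟩
      sumTo q (λ m → α g * (σ ^ m * α (g ℕ.+ k ℕ.+ r ℕ.* m))) ≡⟨ sum-*ˡ q (α g) _ ⟩
      α g * β (g ℕ.+ k)                                       ≡⟨ *-comm (α g) (β (g ℕ.+ k)) ⟩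
      β (g ℕ.+ k) * α g                                       ∎

  -- In block form the factor `β` at `x + r m + k` is `τ ^ m` times its value at `x + k`. That power
  -- joins `α` and turns the inner sum into the fold by `τ`, the conjugate image.
  expand : ∀ k → sumTo q (λ m → σ ^ m * coefficient (k ℕ.+ r ℕ.* m)) ≈
                 sumTo r (λ x → β (x ℕ.+ k) * foldBy q r τ α x) [ M ]
  expand k = ≈-trans (≈-reflexive (regroup k)) (sum-cong-≈ r λ x _ → inner x)
    where
    rotate : ∀ a b c → (a * b) * c ≡ b * (a * c)
    rotate = solve-∀

    inner : ∀ x → sumTo q (λ m → β (x ℕ.+ r ℕ.* m ℕ.+ k) * α (x ℕ.+ r ℕ.* m)) ≈
                  β (x ℕ.+ k) * foldBy q r τ α x [ M ]
    inner x = ≈-trans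
      (sum-cong-≈ q λ m _ →
        ≈-trans (*-congʳ-≈ (α (x ℕ.+ r ℕ.* m))
                  (≈-trans (≈-reflexive (cong β (+-swap x (r ℕ.* m) k))) (steps m (x ℕ.+ k))))
                (≈-reflexive (rotate (τ ^ m) (β (x ℕ.+ k)) (α (x ℕ.+ r ℕ.* m)))))
      (≈-reflexive (sum-*ˡ q (β (x ℕ.+ k)) _))

  collapse : ∀ k → k ℕ.< r → sumTo q (λ m → σ ^ m * coefficient (k ℕ.+ r ℕ.* m)) ≡ δ n k
  collapse k k<r = begin
    sumTo q (λ m → σ ^ m * coefficient (k ℕ.+ r ℕ.* m))
      ≡⟨ sum-cong q (λ m m<q → cong (λ z → σ ^ m * z) (correlation _ (index< m m<q))) ⟩
    sumTo q (λ m → σ ^ m * δ n (k ℕ.+ r ℕ.* m))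
      ≡⟨ first-only q _ (ℕ.>-nonZero⁻¹ q)
           (λ i → trans (cong (λ z → σ ^ suc i * z) (δ-zero _ (positive i))) (*-zeroʳ (σ ^ suc i))) ⟩
    1ℤ * δ n (k ℕ.+ r ℕ.* 0) ≡⟨ *-identityˡ _ ⟩
    δ n (k ℕ.+ r ℕ.* 0)      ≡⟨ cong (δ n) (trans (cong (k ℕ.+_) (ℕ.*-zeroʳ r)) (ℕ.+-identityʳ k)) ⟩
    δ n k                    ∎
    where
    open ≡-Reasoning
    δ-zero : ∀ j → 0 ℕ.< j → δ n j ≡ 0ℤ
    δ-zero (suc _) _ = refl

    index< : ∀ m → m ℕ.< q → k ℕ.+ r ℕ.* m ℕ.< v
    index< m m<q = ℕ.<-≤-trans (ℕ.+-monoˡ-< (r ℕ.* m) k<r)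
      (subst₂ ℕ._≤_ (ℕ.*-suc r m) (trans (ℕ.*-comm r q) qr≡v) (ℕ.*-monoʳ-≤ r m<q))

    first-only : ∀ l f → 0 ℕ.< l → (∀ i → f (suc i) ≡ 0ℤ) → sumTo l f ≡ f 0
    first-only (suc l) f _ h = trans (sum-first l f)
      (trans (cong (λ z → f 0 + z) (trans (sum-cong l λ i _ → h i) (sum-zero l))) (+-identityʳ (f 0)))

    positive : ∀ i → 0 ℕ.< k ℕ.+ r ℕ.* suc i
    positive i = ℕ.<-≤-trans (ℕ.>-nonZero⁻¹ r) (ℕ.≤-trans (ℕ.m≤m*n r (suc i)) (ℕ.m≤n+m _ k))

  -- The identity D D* = n survives in the image: the same sum of correlations is evaluated once
  -- through the image and once through `correlation`, where for `k < r` only lag 0 can contribute.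
  autocorrelation : ∀ k → k ℕ.< r → sumTo r (λ x → β (x ℕ.+ k) * foldBy q r τ α x) ≈ δ n k [ M ]
  autocorrelation k k<r = ≈-trans (≈-sym (expand k)) (≈-reflexive (collapse k k<r))
-- Sums of nonnegative terms

sum-nonneg : ∀ n {F} → (∀ i → i ℕ.< n → 0ℤ ≤ F i) → 0ℤ ≤ sumTo n F
sum-nonneg zero    h = ≤-refl
sum-nonneg (suc n) h = +-mono-≤ (sum-nonneg n (λ i i<n → h i (ℕ.m<n⇒m<1+n i<n))) (h n ℕ.≤-refl)

nonneg-+≡0 : ∀ {x y} → 0ℤ ≤ x → 0ℤ ≤ y → x + y ≡ 0ℤ → x ≡ 0ℤ × y ≡ 0ℤ
nonneg-+≡0 {+ zero} {+ zero} _ _ _ = refl , refl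

sum≡0⇒terms≡0 : ∀ n F → (∀ i → i ℕ.< n → 0ℤ ≤ F i) → sumTo n F ≡ 0ℤ → ∀ i → i ℕ.< n → F i ≡ 0ℤ
sum≡0⇒terms≡0 (suc n) F h eq i i<1+n with nonneg-+≡0 (sum-nonneg n (λ i i<n → h i (ℕ.m<n⇒m<1+n i<n))) (h n ℕ.≤-refl) eq
... | sum≡0 , Fn≡0 with ℕ.m<1+n⇒m<n∨m≡n i<1+n
...   | inj₁ i<n  = sum≡0⇒terms≡0 n F (λ i i<n → h i (ℕ.m<n⇒m<1+n i<n)) sum≡0 i i<n
...   | inj₂ refl = Fn≡0

FirstNonzero : ℕ → (ℕ → ℤ) → Set
FirstNonzero n F = ∃[ i ] (i ℕ.< n × F i ≢ 0ℤ × (∀ l → l ℕ.< i → F l ≡ 0ℤ))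

firstNonzero? : ∀ n F → (∀ i → i ℕ.< n → F i ≡ 0ℤ) ⊎ FirstNonzero n F
firstNonzero? zero    F = inj₁ λ _ ()
firstNonzero? (suc n) F with firstNonzero? n F
... | inj₂ (i , i<n , first) = inj₂ (i , ℕ.m<n⇒m<1+n i<n , first)
... | inj₁ zeros with F n ≟ 0ℤ
...   | no  Fn≢0 = inj₂ (n , ℕ.≤-refl , Fn≢0 , zeros)
...   | yes Fn≡0 = inj₁ λ i i<1+n → all i (ℕ.m<1+n⇒m<n∨m≡n i<1+n)
  where
  all : ∀ i → i ℕ.< n ⊎ i ≡ n → F i ≡ 0ℤ
  all i (inj₁ i<n)  = zeros i i<n
  all i (inj₂ refl) = Fn≡0

sum≢0⇒firstNonzero : ∀ n F → sumTo n F ≢ 0ℤ → FirstNonzero n F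
sum≢0⇒firstNonzero n F sum≢0 with firstNonzero? n F
... | inj₂ first = first
... | inj₁ zeros = contradiction (trans (sum-cong n zeros) (sum-zero n)) sum≢0

-- Lists

nth : ∀ {A : Set} → A → List A → ℕ → A
nth d []       _       = d
nth d (x ∷ xs) zero    = x
nth d (x ∷ xs) (suc n) = nth d xs n

words : ∀ {A : Set} → ℕ → List A → List (List A)
words zero    xs = [] ∷ []
words (suc n) xs = cartesianProductWith _∷_ xs (words n xs)

words-complete : ∀ {A : Set} {xs : List A} n (f : ℕ → A) → (∀ i → i ℕ.< n → f i ∈ xs) → applyUpTo f n ∈ words n xs
words-complete zero    f h = here refl
words-complete (suc n) f h =
  ∈-cartesianProductWith⁺ _∷_ (h 0 z<s) (words-complete n (f ∘ suc) (λ i i<n → h (suc i) (s<s i<n)))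

nth-applyUpTo : ∀ {A : Set} (d : A) f n i → i ℕ.< n → nth d (applyUpTo f n) i ≡ f i
nth-applyUpTo d f (suc n) zero    _         = refl
nth-applyUpTo d f (suc n) (suc i) (s<s i<n) = nth-applyUpTo d (f ∘ suc) n i i<n

applyUpTo-cong : ∀ {A : Set} {f g : ℕ → A} n → (∀ i → f i ≡ g i) → applyUpTo f n ≡ applyUpTo g n
applyUpTo-cong zero    f≗g = refl
applyUpTo-cong (suc n) f≗g = cong₂ _∷_ (f≗g 0) (applyUpTo-cong n (f≗g ∘ suc))

drop-applyUpTo : ∀ {A : Set} (f : ℕ → A) k n → drop k (applyUpTo f (k ℕ.+ n)) ≡ applyUpTo (λ i → f (k ℕ.+ i)) n
drop-applyUpTo f zero    n = refl
drop-applyUpTo f (suc k) n = drop-applyUpTo (f ∘ suc) k n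

-- Residues

≈⇒% : ∀ {n a b} .{{_ : NonZero n}} → + a ≈ + b [ + n ] → a ℕ.% n ≡ b ℕ.% n
≈⇒% {n} {a} {b} (divisible (divides (+ k) eq)) = trans (cong (ℕ._% n) a≡b+kn) (ℕ.[m+kn]%n≡m%n b k n)
  where
  a≡b+kn : a ≡ b ℕ.+ k ℕ.* n
  a≡b+kn = +-injective (trans (difference-+ (+ a) (+ b)) (cong (λ z → + b + z) (trans eq (sym (pos-* k n)))))
    where
    difference-+ : ∀ x y → x ≡ y + (x - y)
    difference-+ = solve-∀
≈⇒% {n} {a} {b} (divisible (divides -[1+ k ] eq)) =
  sym (≈⇒% (divisible (divides (+ suc k) (trans (negate (+ b) (+ a)) (trans (cong -_ eq) (neg-distribˡ-* -[1+ k ] (+ n)))))))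
  where
  negate : ∀ x y → x - y ≡ - (y - x)
  negate = solve-∀

residue-≈ : ∀ x n .{{_ : NonZero n}} → + (x %ℕ n) ≈ x [ + n ]
residue-≈ x n = divisible (divides (- (x /ℕ n)) (begin
  + (x %ℕ n) - x                                      ≡⟨ cong (λ y → + (x %ℕ n) - y) (a≡a%ℕn+[a/ℕn]*n x n) ⟩
  + (x %ℕ n) - (+ (x %ℕ n) + (x /ℕ n) * + n)          ≡⟨ cancel (+ (x %ℕ n)) (x /ℕ n) (+ n) ⟩
  - (x /ℕ n) * + n                                    ∎))
  where
  open ≡-Reasoning
  cancel : ∀ a b c → a - (a + b * c) ≡ - b * c
  cancel = solve-∀

dot : List ℕ → List ℕ → ℕ
dot (x ∷ xs) (y ∷ ys) = x ℕ.* y ℕ.+ dot xs ys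
dot _        _        = 0

dot-sum : ∀ f g {m n} → n ℕ.≤ m → + dot (applyUpTo f m) (applyUpTo g n) ≡ sumTo n (λ i → + f i * + g i)
dot-sum f g {zero}  {zero}  _           = refl
dot-sum f g {suc m} {zero}  _           = refl
dot-sum f g {suc m} {suc n} (ℕ.s≤s n≤m) = begin
  + (f 0 ℕ.* g 0) + + dot (applyUpTo (f ∘ suc) m) (applyUpTo (g ∘ suc) n)
    ≡⟨ cong₂ _+_ (pos-* (f 0) (g 0)) (dot-sum (f ∘ suc) (g ∘ suc) n≤m) ⟩
  + f 0 * + g 0 + sumTo n (λ i → + f (suc i) * + g (suc i))
    ≡⟨ sum-first n (λ i → + f i * + g i) ⟨
  sumTo (suc n) (λ i → + f i * + g i) ∎
  where open ≡-Reasoning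

-- The autocorrelations modulo n of the sequence that starts with l and
-- continues with a(x + |l|) = τ a(x).
Uncorrelated : (n τ : ℕ) .{{_ : NonZero n}} → List ℕ → Set
Uncorrelated n τ l = All (λ k → dot (drop k (l ++ map (λ r → (τ ℕ.* r) ℕ.% n) l)) l ℕ.% n ≡ 0) (upTo 10)

uncorrelated? : ∀ n τ .{{_ : NonZero n}} l → Dec (Uncorrelated n τ l)
uncorrelated? n τ l = all? (λ k → dot (drop k (l ++ map (λ r → (τ ℕ.* r) ℕ.% n) l)) l ℕ.% n ℕ.≟ 0) (upTo 10)

module Residues (n τ : ℕ) .{{_ : NonZero n}} (β : ℕ → ℤ)
                (step : ∀ g → β (g ℕ.+ 10) ≈ + τ * β g [ + n ])
                (autocorrelation : ∀ k → k ℕ.< 10 → sumTo 10 (λ x → β (x ℕ.+ k) * β x) ≈ 0ℤ [ + n ]) where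

  residue : ℕ → ℕ
  residue g = β g %ℕ n

  residue< : ∀ g → residue g ℕ.< n
  residue< g = n%ℕd<d (β g) n

  residue-step : ∀ g → (τ ℕ.* residue g) ℕ.% n ≡ residue (10 ℕ.+ g)
  residue-step g = begin
    (τ ℕ.* residue g) ℕ.% n    ≡⟨ ≈⇒% (≈-trans (≈-reflexive (pos-* τ (residue g)))
                                      (≈-trans (*-congˡ-≈ (+ τ) (residue-≈ (β g) n))
                                      (≈-trans (≈-sym (step g))
                                      (≈-trans (≈-reflexive (cong β (ℕ.+-comm g 10)))
                                               (≈-sym (residue-≈ (β (10 ℕ.+ g)) n)))))) ⟩
    residue (10 ℕ.+ g) ℕ.% n   ≡⟨ ℕ.m<n⇒m%n≡m (residue< (10 ℕ.+ g)) ⟩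
    residue (10 ℕ.+ g)         ∎
    where open ≡-Reasoning

  residues : List ℕ
  residues = applyUpTo residue 10

  continuation : residues ++ map (λ r → (τ ℕ.* r) ℕ.% n) residues ≡ applyUpTo residue 20
  continuation = cong (residues ++_) (trans (map-applyUpTo residue (λ r → (τ ℕ.* r) ℕ.% n) 10) (applyUpTo-cong 10 residue-step))

  uncorrelated : Uncorrelated n τ residues
  uncorrelated = All.tabulate λ {k} k∈ → lag k (∈-upTo⁻ k∈)
    where
    lag : ∀ k → k ℕ.< 10 → dot (drop k (residues ++ map (λ r → (τ ℕ.* r) ℕ.% n) residues)) residues ℕ.% n ≡ 0
    lag k k<10 = trans (≈⇒% {b = 0} (≈-trans (≈-reflexive sum) (≈-trans (sum-cong-≈ 10 λ i _ → term i) (autocorrelation k k<10))))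
                       (ℕ.m*n%n≡0 0 n)
      where
      open ≡-Reasoning
      sum : + dot (drop k (residues ++ map (λ r → (τ ℕ.* r) ℕ.% n) residues)) residues ≡
            sumTo 10 (λ i → + residue (k ℕ.+ i) * + residue i)
      sum = begin
        + dot (drop k (residues ++ map (λ r → (τ ℕ.* r) ℕ.% n) residues)) residues
          ≡⟨ cong (λ l → + dot (drop k l) residues)
               (trans continuation (cong (applyUpTo residue) (sym (ℕ.m+[n∸m]≡n (ℕ.≤-trans (ℕ.<⇒≤ k<10) (ℕ.m≤m+n 10 10)))))) ⟩
        + dot (drop k (applyUpTo residue (k ℕ.+ (20 ℕ.∸ k)))) residues
          ≡⟨ cong (λ l → + dot l residues) (drop-applyUpTo residue k (20 ℕ.∸ k)) ⟩
        + dot (applyUpTo (λ i → residue (k ℕ.+ i)) (20 ℕ.∸ k)) residues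
          ≡⟨ dot-sum (λ i → residue (k ℕ.+ i)) residue (ℕ.∸-monoʳ-≤ 20 (ℕ.<⇒≤ k<10)) ⟩
        sumTo 10 (λ i → + residue (k ℕ.+ i) * + residue i) ∎

      term : ∀ i → + residue (k ℕ.+ i) * + residue i ≈ β (i ℕ.+ k) * β i [ + n ]
      term i = *-cong-≈ (≈-trans (residue-≈ (β (k ℕ.+ i)) n) (≈-reflexive (cong β (ℕ.+-comm k i)))) (residue-≈ (β i) n)

  residues∈words : residues ∈ words 10 (upTo n)
  residues∈words = words-complete 10 residue (λ i _ → ∈-upTo⁺ (residue< i))

  ∣residue⇒∣ : ∀ {m} → m ∣ + n → ∀ g → m ∣ + residue g → m ∣ β g
  ∣residue⇒∣ {m} m∣n g m∣r =
    subst (m ∣_) (cancel (β g) (+ residue g)) (∣m∣n⇒∣m+n m∣r (∣m⇒∣-m (∣-trans m∣n (_≈_[_].difference (residue-≈ (β g) n)))))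
    where
    cancel : ∀ b r → r + - (r - b) ≡ b
    cancel = solve-∀

-- Uncorrelated sequences modulo 3, 2 and 4

abstract
  -- F_3[C_10] is semisimple, and at a tenth root of unity ω the conjugate F(ω⁻¹) = F(ω⁹) equals
  -- F(ω)⁹. So F F* = 0 gives F(ω)¹⁰ = 0 for every ω, whence F = 0.
  uncorrelated-mod-3 : All (λ l → Uncorrelated 3 1 l → All (_≡ 0) l) (words 10 (upTo 3))
  uncorrelated-mod-3 = toWitness {a? = all? (λ l → uncorrelated? 3 1 l →-dec all? (ℕ._≟ 0) l) _} _

  -- Over F_2, x¹⁰ - 1 is the square of x⁵ - 1, so vanishing at the fifth roots of unity only yields
  -- a multiple of 1 + x⁵, that is, a sequence of period 5.
  uncorrelated-mod-2 : All (λ l → Uncorrelated 2 1 l → All (λ i → nth 0 l i ≡ nth 0 l (5 ℕ.+ i)) (upTo 5)) (words 10 (upTo 2))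
  uncorrelated-mod-2 =
    toWitness {a? = all? (λ l → uncorrelated? 2 1 l →-dec all? (λ i → nth 0 l i ℕ.≟ nth 0 l (5 ℕ.+ i)) (upTo 5)) _} _

congruentPair? : ∀ (rs : ℕ × ℕ) → Dec (proj₁ rs ℕ.% 2 ≡ proj₂ rs ℕ.% 2)
congruentPair? (r , s) = r ℕ.% 2 ℕ.≟ s ℕ.% 2

-- Pairing the entries at `i` and `5 + i` lets the result modulo 2 cut the enumeration modulo 4 from
-- 4¹⁰ sequences to 8⁵.
congruentPairs : List (ℕ × ℕ)
congruentPairs = filter congruentPair? (cartesianProduct (upTo 4) (upTo 4))

abstract
  -- In Z[x]/(x¹⁰ + 1) the square of 1 + x⁵ is 2x⁵, and 1 + x⁵ times its conjugate is 2. By the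
  -- result modulo 2, c = (1 + x⁵)d; then 2 d d* ≡ 0 mod 4, so d is again a multiple of 1 + x⁵ and c
  -- one of 2.
  uncorrelated-mod-4 : All (λ rs → Uncorrelated 4 3 (map proj₁ rs ++ map proj₂ rs) → All (2 ℕ.∣_) (map proj₁ rs ++ map proj₂ rs))
                           (words 5 congruentPairs)
  uncorrelated-mod-4 = toWitness {a? = all? (λ rs → uncorrelated? 4 3 (map proj₁ rs ++ map proj₂ rs) →-dec
                                                     all? (2 ℕ.∣?_) (map proj₁ rs ++ map proj₂ rs)) _} _
-- Cosets

_!_ : List ℤ → ℕ → ℤ
_!_ = nth 0ℤ

twisted : ℤ → List ℤ → ℤ
twisted σ A = sumTo 6 (λ m → σ ^ m * A ! m)

total alternating : List ℤ → ℤ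
total       = twisted 1ℤ
alternating = twisted -1ℤ

halved : List ℤ → ℕ → ℤ
halved A m = A ! m + A ! (3 ℕ.+ m)

square : ℤ → ℤ
square x = x * x

halvedNorm norm : List ℤ → ℤ
halvedNorm A = sumTo 3 (λ m → square (halved A m))
norm A       = sumTo 6 (λ m → square (A ! m))

-- Vanishes if A alternates in sign, so that such cosets need not be told
-- apart from zero when characters of order 60 are evaluated.
excess : List ℤ → ℤ
excess A = + 6 * norm A - square (alternating A)

-- One difference suffices for b to be constant modulo 3 on the coset: as the three halved entries
-- have sum 0 modulo 3, equality of two of them gives the third.
Candidate : List ℤ → Set
Candidate A = (+ 3 ∣ total A) × (+ 2 ∣ alternating A) × (+ 3 ∣ (halved A 1 - halved A 0))

candidate? : ∀ A → Dec (Candidate A)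
candidate? A = (+ 3 ∣? total A) ×-dec (+ 2 ∣? alternating A) ×-dec (+ 3 ∣? (halved A 1 - halved A 0))

cosetWords candidates : List (List ℤ)
cosetWords = words 6 (0ℤ ∷ 1ℤ ∷ -1ℤ ∷ [])
candidates = filter candidate? cosetWords

cosetOf : (ℕ → ℤ) → ℕ → List ℤ
cosetOf α x = applyUpTo (λ m → α (x ℕ.+ 10 ℕ.* m)) 6

δ-≈ : ∀ {M} → M ∣ + 36 → ∀ k → δ (+ 36) k ≈ 0ℤ [ M ]
δ-≈ M∣36 zero    = ∣⇒≈0 M∣36
δ-≈ M∣36 (suc k) = ≈-refl

≈-weaken : ∀ {M x y} → x ≈ y [ 0ℤ ] → x ≈ y [ M ]
≈-weaken = ≈-reflexive ∘ ≈⇒≡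

-- Norms and divisibility for the images of D

module Facts {α} (D : CW 60 (+ 36) α) where

  open CW D

  coset : ℕ → List ℤ
  coset = cosetOf α

  module Total       = Projection D 0ℤ 6 10 refl 1ℤ 1ℤ ≈-refl ≈-refl
  module Alternating = Projection D 0ℤ 6 10 refl -1ℤ -1ℤ ≈-refl ≈-refl
  module Halved      = Projection D 0ℤ 2 30 refl 1ℤ 1ℤ ≈-refl ≈-refl

  private
    f c b : ℕ → ℤ
    f = Total.β
    c = Alternating.β
    b = Halved.β

  square-sum : (β : ℕ → ℤ) → sumTo 10 (λ x → β (x ℕ.+ 0) * β x) ≡ + 36 → sumTo 10 (λ x → square (β x)) ≡ + 36
  square-sum β = trans (sum-cong 10 {λ x → square (β x)} {λ x → β (x ℕ.+ 0) * β x}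
    λ x _ → cong (λ y → β y * β x) (sym (ℕ.+-identityʳ x)))

  sum-total² : sumTo 10 (λ x → square (total (coset x))) ≡ + 36
  sum-total² = square-sum f (≈⇒≡ (Total.autocorrelation 0 z<s))

  sum-alternating² : sumTo 10 (λ x → square (alternating (coset x))) ≡ + 36
  sum-alternating² = square-sum c (≈⇒≡ (Alternating.autocorrelation 0 z<s))

  sum-norm : sumTo 10 (λ x → norm (coset x)) ≡ + 36
  sum-norm = trans (sym (sum-blocks 6 10 (λ g → square (α g))))
    (trans (sum-cong 60 {λ g → square (α g)} {λ g → α (g ℕ.+ 0) * α g}
              λ g _ → cong (λ h → α h * α g) (sym (ℕ.+-identityʳ g)))
           (correlation 0 z<s))

  -- By Parseval on C_6, `6 * norm` is the sum of the squared absolute values of all six characters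
  -- on a coset; the excess omits the one with g¹⁰ ↦ -1. Hence 6 · 36 - 36 = 180.
  sum-excess : sumTo 10 (λ x → excess (coset x)) ≡ + 180
  sum-excess = begin
    sumTo 10 (λ x → + 6 * norm (coset x) - square (alternating (coset x)))
      ≡⟨ sum-cong 10 {λ x → excess (coset x)} {λ x → + 6 * N x + -1ℤ * C x} (λ x _ → minus (+ 6 * N x) (C x)) ⟩
    sumTo 10 (λ x → + 6 * N x + -1ℤ * C x)
      ≡⟨ sum-+ 10 (λ x → + 6 * N x) (λ x → -1ℤ * C x) ⟩
    sumTo 10 (λ x → + 6 * N x) + sumTo 10 (λ x → -1ℤ * C x)
      ≡⟨ cong₂ _+_ (trans (sum-*ˡ 10 (+ 6) N) (cong (λ z → + 6 * z) sum-norm))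
                   (trans (sum-*ˡ 10 -1ℤ C) (cong (λ z → -1ℤ * z) sum-alternating²)) ⟩
    + 180 ∎
    where
    open ≡-Reasoning
    N C : ℕ → ℤ
    N x = norm (coset x)
    C x = square (alternating (coset x))
    minus : ∀ a b → a - b ≡ a + -1ℤ * b
    minus = solve-∀

  b≡halved : ∀ x y → b (x ℕ.+ 10 ℕ.* y) ≡ α (x ℕ.+ 10 ℕ.* y) + α (x ℕ.+ 10 ℕ.* (3 ℕ.+ y))
  b≡halved x y = begin
    0ℤ + 1ℤ * α (x ℕ.+ 10 ℕ.* y ℕ.+ 30 ℕ.* 0) + 1ℤ * α (x ℕ.+ 10 ℕ.* y ℕ.+ 30 ℕ.* 1)
      ≡⟨ cong₂ (λ i j → 0ℤ + 1ℤ * α i + 1ℤ * α j) (ℕ.+-identityʳ _) (index x y) ⟩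
    0ℤ + 1ℤ * α (x ℕ.+ 10 ℕ.* y) + 1ℤ * α (x ℕ.+ 10 ℕ.* (3 ℕ.+ y))
      ≡⟨ units (α (x ℕ.+ 10 ℕ.* y)) (α (x ℕ.+ 10 ℕ.* (3 ℕ.+ y))) ⟩
    α (x ℕ.+ 10 ℕ.* y) + α (x ℕ.+ 10 ℕ.* (3 ℕ.+ y)) ∎
    where
    open ≡-Reasoning
    index : ∀ x y → x ℕ.+ 10 ℕ.* y ℕ.+ 30 ℕ.* 1 ≡ x ℕ.+ 10 ℕ.* (3 ℕ.+ y)
    index = ℕ.solve-∀
    units : ∀ a b → 0ℤ + 1ℤ * a + 1ℤ * b ≡ a + b
    units = solve-∀

  halved-blocks : ∀ k → k ℕ.< 30 →
    sumTo 10 (λ x → sumTo 3 (λ y → b (x ℕ.+ k ℕ.+ 10 ℕ.* y) * b (x ℕ.+ 10 ℕ.* y))) ≡ δ (+ 36) k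
  halved-blocks k k<30 = begin
    sumTo 10 (λ x → sumTo 3 (λ y → b (x ℕ.+ k ℕ.+ 10 ℕ.* y) * b (x ℕ.+ 10 ℕ.* y)))
      ≡⟨ sum-cong 10 {outer λ x y → x ℕ.+ k ℕ.+ 10 ℕ.* y} {outer λ x y → x ℕ.+ 10 ℕ.* y ℕ.+ k} (λ x _ →
           sum-cong 3 {inner (λ y → x ℕ.+ k ℕ.+ 10 ℕ.* y) x} {inner (λ y → x ℕ.+ 10 ℕ.* y ℕ.+ k) x} λ y _ →
             cong (λ i → b i * b (x ℕ.+ 10 ℕ.* y)) (+-swap x k (10 ℕ.* y))) ⟩
    sumTo 10 (λ x → sumTo 3 (λ y → b (x ℕ.+ 10 ℕ.* y ℕ.+ k) * b (x ℕ.+ 10 ℕ.* y)))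
      ≡⟨ sum-blocks 3 10 (λ g → b (g ℕ.+ k) * b g) ⟨
    sumTo 30 (λ g → b (g ℕ.+ k) * b g)
      ≡⟨ ≈⇒≡ (Halved.autocorrelation k k<30) ⟩
    δ (+ 36) k ∎
    where
    open ≡-Reasoning
    inner : (ℕ → ℕ) → ℕ → ℕ → ℤ
    inner i x y = b (i y) * b (x ℕ.+ 10 ℕ.* y)
    outer : (ℕ → ℕ → ℕ) → ℕ → ℤ
    outer i x = sumTo 3 (inner (i x) x)

  sum-halvedNorm : sumTo 10 (λ x → halvedNorm (coset x)) ≡ + 36
  sum-halvedNorm = trans (sum-cong 10 {λ x → halvedNorm (coset x)}
      {λ x → sumTo 3 (λ y → b (x ℕ.+ 0 ℕ.+ 10 ℕ.* y) * b (x ℕ.+ 10 ℕ.* y))} (λ x _ → term x))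
      (halved-blocks 0 z<s)
    where
    term : ∀ x → halvedNorm (coset x) ≡ sumTo 3 (λ y → b (x ℕ.+ 0 ℕ.+ 10 ℕ.* y) * b (x ℕ.+ 10 ℕ.* y))
    term x = cong₂ _+_ (cong₂ _+_ (cong (λ z → 0ℤ + z) (b² 0)) (b² 1)) (b² 2)
      where
      b² : ∀ y → square (α (x ℕ.+ 10 ℕ.* y) + α (x ℕ.+ 10 ℕ.* (3 ℕ.+ y))) ≡
                     b (x ℕ.+ 0 ℕ.+ 10 ℕ.* y) * b (x ℕ.+ 10 ℕ.* y)
      b² y = cong₂ _*_ (trans (sym (b≡halved x y)) (cong (λ z → b (z ℕ.+ 10 ℕ.* y)) (sym (ℕ.+-identityʳ x))))
                           (sym (b≡halved x y))

  3∣total<10 : ∀ x → x ℕ.< 10 → + 3 ∣ f x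
  3∣total<10 x x<10 = R.∣residue⇒∣ ∣-refl x (subst (λ r → + 3 ∣ + r) (sym residue≡0) (divides 0ℤ refl))
    where
    module R = Residues 3 1 f (λ g → ≈-weaken (Total.step g))
      (λ k k<10 → ≈-trans (≈-weaken (Total.autocorrelation k k<10)) (δ-≈ (divides (+ 12) refl) k))
    residue≡0 : R.residue x ≡ 0
    residue≡0 = All.lookup (All.lookup uncorrelated-mod-3 R.residues∈words R.uncorrelated) (∈-applyUpTo⁺ R.residue x<10)

  -- Needed beyond the first ten indices, because the slopes are taken at `x + k` and their
  -- periodicity is used at every index.
  f-3≈0 : ∀ x → f x ≈ 0ℤ [ + 3 ]
  f-3≈0 x = ≈-trans (≈-reflexive (cong f (trans (ℕ.m≡m%n+[m/n]*n x 10) (cong (x ℕ.% 10 ℕ.+_) (ℕ.*-comm (x ℕ./ 10) 10)))))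
           (≈-trans (≈-weaken (Total.steps (x ℕ./ 10) (x ℕ.% 10)))
           (≈-trans (*-congˡ-≈ (1ℤ ^ (x ℕ./ 10)) (∣⇒≈0 (3∣total<10 (x ℕ.% 10) (ℕ.m%n<n x 10))))
                    (≈-reflexive (*-zeroʳ (1ℤ ^ (x ℕ./ 10))))))

  2∣alternating<10 : ∀ x → x ℕ.< 10 → + 2 ∣ c x
  2∣alternating<10 x x<10 = R4.∣residue⇒∣ (divides (+ 2) refl) x (∣ᵤ⇒∣ (All.lookup evens (∈-applyUpTo⁺ R4.residue x<10)))
    where
    -1≈1 : -1ℤ ≈ + 1 [ + 2 ]
    -1≈1 = divisible (divides -1ℤ refl)
    -1≈3 : -1ℤ ≈ + 3 [ + 4 ]
    -1≈3 = divisible (divides -1ℤ refl)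

    -- Modulo 2 the sign of the negacyclic sequence c disappears and c has period 10; modulo 4 it
    -- remains, as the multiplier 3.
    module R2 = Residues 2 1 c
      (λ g → ≈-trans (≈-weaken (Alternating.step g)) (*-congʳ-≈ (c g) -1≈1))
      (λ k k<10 → ≈-trans (≈-weaken (Alternating.autocorrelation k k<10)) (δ-≈ (divides (+ 18) refl) k))
    module R4 = Residues 4 3 c
      (λ g → ≈-trans (≈-weaken (Alternating.step g)) (*-congʳ-≈ (c g) -1≈3))
      (λ k k<10 → ≈-trans (≈-weaken (Alternating.autocorrelation k k<10)) (δ-≈ (divides (+ 9) refl) k))

    residues-congruent : ∀ i → i ℕ.< 5 → R2.residue i ≡ R2.residue (5 ℕ.+ i)
    residues-congruent i i<5 = begin
      R2.residue i             ≡⟨ nth-applyUpTo 0 R2.residue 10 i (ℕ.<-≤-trans i<5 (ℕ.m≤m+n 5 5)) ⟨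
      nth 0 R2.residues i      ≡⟨ All.lookup (All.lookup uncorrelated-mod-2 R2.residues∈words R2.uncorrelated) (∈-upTo⁺ i<5) ⟩
      nth 0 R2.residues (5 ℕ.+ i) ≡⟨ nth-applyUpTo 0 R2.residue 10 (5 ℕ.+ i) (ℕ.+-monoʳ-< 5 i<5) ⟩
      R2.residue (5 ℕ.+ i)     ∎
      where open ≡-Reasoning

    residue-mod-2 : ∀ i → R4.residue i ℕ.% 2 ≡ R2.residue i
    residue-mod-2 i = trans (≈⇒% {2} (≈-trans (divisible (∣-trans (divides (+ 2) refl) (_≈_[_].difference (residue-≈ (c i) 4))))
                                              (≈-sym (residue-≈ (c i) 2))))
                            (ℕ.m<n⇒m%n≡m (R2.residue< i))

    pair : ℕ → ℕ × ℕ
    pair i = R4.residue i , R4.residue (5 ℕ.+ i)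

    pair∈ : ∀ i → i ℕ.< 5 → pair i ∈ congruentPairs
    pair∈ i i<5 = ∈-filter⁺ congruentPair? (∈-cartesianProduct⁺ (∈-upTo⁺ (R4.residue< i)) (∈-upTo⁺ (R4.residue< (5 ℕ.+ i))))
      (trans (residue-mod-2 i) (trans (residues-congruent i i<5) (sym (residue-mod-2 (5 ℕ.+ i)))))

    evens : All (2 ℕ.∣_) R4.residues
    evens = All.lookup uncorrelated-mod-4 (words-complete 5 pair pair∈) R4.uncorrelated

  -- Modulo 3 the halved coset is (u, u + d, u + 2d) where d is its slope.
  slope : ℕ → ℤ
  slope x = b (x ℕ.+ 10 ℕ.* 1) - b (x ℕ.+ 10 ℕ.* 0)

  b-sum : ∀ x → f x ≡ b (x ℕ.+ 10 ℕ.* 0) + b (x ℕ.+ 10 ℕ.* 1) + b (x ℕ.+ 10 ℕ.* 2)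
  b-sum x = trans (rearrange (α (x ℕ.+ 0)) (α (x ℕ.+ 10)) (α (x ℕ.+ 20)) (α (x ℕ.+ 30)) (α (x ℕ.+ 40)) (α (x ℕ.+ 50)))
                  (sym (cong₂ _+_ (cong₂ _+_ (b≡halved x 0) (b≡halved x 1)) (b≡halved x 2)))
    where
    rearrange : ∀ a₀ a₁ a₂ a₃ a₄ a₅ →
      0ℤ + 1ℤ * a₀ + 1ℤ * a₁ + 1ℤ * a₂ + 1ℤ * a₃ + 1ℤ * a₄ + 1ℤ * a₅ ≡ (a₀ + a₃) + (a₁ + a₄) + (a₂ + a₅)
    rearrange = solve-∀

  -- The change of slope is the second difference of b, which modulo 3 is the sum of b over the
  -- coset, that is, f.
  slope-step : ∀ x → slope (x ℕ.+ 10) ≈ + 1 * slope x [ + 3 ]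
  slope-step x = divisible (subst (+ 3 ∣_) second-difference
      (∣m∣n⇒∣m-n (subst (+ 3 ∣_) (b-sum x) (≈0⇒∣ (f-3≈0 x))) (∣m⇒∣m*n (b (x ℕ.+ 10 ℕ.* 1)) ∣-refl)))
    where
    regroup : ∀ b₀ b₁ b₂ → b₀ + b₁ + b₂ - + 3 * b₁ ≡ (b₂ - b₁) - + 1 * (b₁ - b₀)
    regroup = solve-∀
    second-difference : b (x ℕ.+ 10 ℕ.* 0) + b (x ℕ.+ 10 ℕ.* 1) + b (x ℕ.+ 10 ℕ.* 2) - + 3 * b (x ℕ.+ 10 ℕ.* 1) ≡
                 slope (x ℕ.+ 10) - + 1 * slope x
    second-difference = trans (regroup (b (x ℕ.+ 10 ℕ.* 0)) (b (x ℕ.+ 10 ℕ.* 1)) (b (x ℕ.+ 10 ℕ.* 2)))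
      (cong₂ (λ i j → (b i - b j) - + 1 * slope x) (sym (ℕ.+-assoc x 10 10)) (sym (ℕ.+-assoc x 10 0)))

  -- With entries u + dy and u′ + d′y for y = 0, 1, 2, the product sum is 3uu′ + 3(ud′ + u′d) +
  -- 5dd′, and only the last term survives modulo 3.
  slope-product : ∀ z x → sumTo 3 (λ y → b (z ℕ.+ 10 ℕ.* y) * b (x ℕ.+ 10 ℕ.* y)) ≈ + 2 * (slope z * slope x) [ + 3 ]
  slope-product z x = divisible (subst (+ 3 ∣_)
      (identity (b (z ℕ.+ 10 ℕ.* 0)) (b (z ℕ.+ 10 ℕ.* 1)) (b (z ℕ.+ 10 ℕ.* 2)) (b (x ℕ.+ 10 ℕ.* 0)) (b (x ℕ.+ 10 ℕ.* 1)) (b (x ℕ.+ 10 ℕ.* 2)))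
      (∣m∣n⇒∣m+n (∣m∣n⇒∣m-n (∣m⇒∣m*n (b (x ℕ.+ 10 ℕ.* 2)) (3∣sum z)) (∣n⇒∣m*n (b (z ℕ.+ 10 ℕ.* 0) + b (z ℕ.+ 10 ℕ.* 1)) (3∣sum x)))
                 (∣m⇒∣m*n _ ∣-refl)))
    where
    3∣sum : ∀ x → + 3 ∣ b (x ℕ.+ 10 ℕ.* 0) + b (x ℕ.+ 10 ℕ.* 1) + b (x ℕ.+ 10 ℕ.* 2)
    3∣sum x = subst (+ 3 ∣_) (b-sum x) (≈0⇒∣ (f-3≈0 x))
    identity : ∀ b₀ b₁ b₂ c₀ c₁ c₂ →
      (b₀ + b₁ + b₂) * c₂ - (b₀ + b₁) * (c₀ + c₁ + c₂) + + 3 * (b₀ * c₁ + b₁ * c₀) ≡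
      (0ℤ + b₀ * c₀ + b₁ * c₁ + b₂ * c₂) - + 2 * ((b₁ - b₀) * (c₁ - c₀))
    identity = solve-∀

  slope-autocorrelation : ∀ k → k ℕ.< 10 → sumTo 10 (λ x → slope (x ℕ.+ k) * slope x) ≈ 0ℤ [ + 3 ]
  slope-autocorrelation k k<10 = ∣⇒≈0 (subst (+ 3 ∣_) (halve S) (∣m∣n⇒∣m-n (∣m⇒∣m*n S ∣-refl) (≈0⇒∣ twice)))
    where
    S = sumTo 10 (λ x → slope (x ℕ.+ k) * slope x)
    -- 2 is invertible modulo 3, so the factor from `slope-product` can be removed.
    halve : ∀ s → + 3 * s - + 2 * s ≡ s
    halve = solve-∀
    twice : + 2 * S ≈ 0ℤ [ + 3 ]
    twice = ≈-trans (≈-reflexive (sym (sum-*ˡ 10 (+ 2) (λ x → slope (x ℕ.+ k) * slope x))))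
           (≈-trans (sum-cong-≈ 10 {λ x → + 2 * (slope (x ℕ.+ k) * slope x)}
                       {λ x → sumTo 3 (λ y → b (x ℕ.+ k ℕ.+ 10 ℕ.* y) * b (x ℕ.+ 10 ℕ.* y))}
                       (λ x _ → ≈-sym (slope-product (x ℕ.+ k) x)))
           (≈-trans (≈-reflexive (halved-blocks k (ℕ.<-≤-trans k<10 (ℕ.m≤m+n 10 20)))) (δ-≈ (divides (+ 12) refl) k)))

  3∣slope : ∀ x → x ℕ.< 10 → + 3 ∣ slope x
  3∣slope x x<10 = R.∣residue⇒∣ ∣-refl x (subst (λ r → + 3 ∣ + r) (sym residue≡0) (divides 0ℤ refl))
    where
    module R = Residues 3 1 slope slope-step slope-autocorrelation
    residue≡0 : R.residue x ≡ 0
    residue≡0 = All.lookup (All.lookup uncorrelated-mod-3 R.residues∈words R.uncorrelated) (∈-applyUpTo⁺ R.residue x<10)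

  ternary∈ : ∀ {z} → Ternary z → z ∈ 0ℤ ∷ 1ℤ ∷ -1ℤ ∷ []
  ternary∈ (inj₁ eq)        = here eq
  ternary∈ (inj₂ (inj₁ eq)) = there (here eq)
  ternary∈ (inj₂ (inj₂ eq)) = there (there (here eq))

  coset∈candidates : ∀ x → x ℕ.< 10 → coset x ∈ candidates
  coset∈candidates x x<10 = ∈-filter⁺ candidate?
    (words-complete 6 (λ m → α (x ℕ.+ 10 ℕ.* m)) (λ m _ → ternary∈ (ternary (x ℕ.+ 10 ℕ.* m))))
    (3∣total<10 x x<10 , 2∣alternating<10 x x<10 ,
     subst (+ 3 ∣_) (cong₂ _-_ (b≡halved x 1) (b≡halved x 0)) (3∣slope x x<10))

-- Normalisation

-- D is constant and nonzero on the coset 0, which is whole.  Among the others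
-- the leader is the first with b ≠ 0; those before it are flat.
data Role : Set where
  whole flat leader free : Role

roleAfter role : ℕ → ℕ → Role
roleAfter zero    zero    = leader
roleAfter zero    (suc x) = free
roleAfter (suc i) zero    = flat
roleAfter (suc i) (suc x) = roleAfter i x
role i zero    = whole
role i (suc x) = roleAfter i x

-- Every coset with f = 0 and b ≠ 0 has this form after a rotation and a
-- change of sign.
Normal : List ℤ → Set
Normal A = halved A 0 ≡ 1ℤ × halved A 1 ≡ 1ℤ ×
           (alternating A ≡ - + 2 ⊎ (alternating A ≡ 0ℤ × A ! 0 ≡ 0ℤ))

normal? : ∀ A → Dec (Normal A)
normal? A = (halved A 0 ≟ 1ℤ) ×-dec (halved A 1 ≟ 1ℤ) ×-dec
            ((alternating A ≟ - + 2) ⊎-dec ((alternating A ≟ 0ℤ) ×-dec (A ! 0 ≟ 0ℤ)))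

Fits : Role → List ℤ → Set
Fits whole  A = total A ≢ 0ℤ
Fits flat   A = total A ≡ 0ℤ × halvedNorm A ≡ 0ℤ
Fits leader A = total A ≡ 0ℤ × Normal A
Fits free   A = total A ≡ 0ℤ

fits? : ∀ ρ A → Dec (Fits ρ A)
fits? whole  A = ¬? (total A ≟ 0ℤ)
fits? flat   A = (total A ≟ 0ℤ) ×-dec (halvedNorm A ≟ 0ℤ)
fits? leader A = (total A ≟ 0ℤ) ×-dec normal? A
fits? free   A = total A ≟ 0ℤ

symmetries : List (ℤ × ℕ)
symmetries = cartesianProduct (1ℤ ∷ -1ℤ ∷ []) (upTo 6)

transform : ℤ × ℕ → List ℤ → List ℤ
transform (σ , j) A = applyUpTo (λ m → σ * A ! ((m ℕ.+ j) ℕ.% 6)) 6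

abstract
  -- These quantities serve as search costs, so they must agree with their absolute values. For the
  -- excess this is the Cauchy-Schwarz inequality.
  candidates-nonneg : All (λ A → 0ℤ ≤ excess A × 0ℤ ≤ halvedNorm A ×
                                 0ℤ ≤ square (alternating A) × 0ℤ ≤ square (total A)) candidates
  candidates-nonneg = toWitness
    {a? = all? (λ A → (0ℤ ≤? excess A) ×-dec (0ℤ ≤? halvedNorm A) ×-dec
                      (0ℤ ≤? square (alternating A)) ×-dec (0ℤ ≤? square (total A))) _} _

  -- `total` and `alternating` have the same parity, so 6 divides `total`. With six entries in {0,
  -- ±1} a nonzero total is ±6: the coset is constant and its three halved entries are ±2.
  candidates-whole : All (λ A → total A ≢ 0ℤ → square (total A) ≡ + 36 × halvedNorm A ≡ + 12) candidates
  candidates-whole = toWitness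
    {a? = all? (λ A → ¬? (total A ≟ 0ℤ) →-dec (square (total A) ≟ + 36) ×-dec (halvedNorm A ≟ + 12)) _} _

  candidates-total : All (λ A → square (total A) ≡ 0ℤ → total A ≡ 0ℤ) candidates
  candidates-total = toWitness {a? = all? (λ A → (square (total A) ≟ 0ℤ) →-dec (total A ≟ 0ℤ)) _} _

  candidates-transform : All (λ A → All (λ s → (total (transform s A) ≡ 0ℤ → total A ≡ 0ℤ) ×
                                               (total A ≡ 0ℤ → total (transform s A) ≡ 0ℤ) ×
                                               (halvedNorm A ≡ 0ℤ → halvedNorm (transform s A) ≡ 0ℤ))
                                        symmetries) candidates
  candidates-transform = toWitness
    {a? = all? (λ A → all? (λ s → ((total (transform s A) ≟ 0ℤ) →-dec (total A ≟ 0ℤ)) ×-dec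
                                  ((total A ≟ 0ℤ) →-dec (total (transform s A) ≟ 0ℤ)) ×-dec
                                  ((halvedNorm A ≟ 0ℤ) →-dec (halvedNorm (transform s A) ≟ 0ℤ))) _) _} _

  candidates-normal : All (λ A → total A ≡ 0ℤ → halvedNorm A ≢ 0ℤ →
                                 Any (λ s → Normal (transform s A)) symmetries) candidates
  candidates-normal = toWitness
    {a? = all? (λ A → (total A ≟ 0ℤ) →-dec (¬? (halvedNorm A ≟ 0ℤ) →-dec
                       any? (λ s → normal? (transform s A)) symmetries)) _} _

periodic-* : ∀ {v n α} → CW v n α → ∀ k g → α (g ℕ.+ v ℕ.* k) ≡ α g
periodic-* {v} {α = α} D zero    g = cong α (trans (cong (g ℕ.+_) (ℕ.*-zeroʳ v)) (ℕ.+-identityʳ g))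
periodic-* {v} {α = α} D (suc k) g = trans (cong α index) (trans (CW.periodic D _) (periodic-* D k g))
  where
  index : g ℕ.+ v ℕ.* suc k ≡ g ℕ.+ v ℕ.* k ℕ.+ v
  index = trans (cong (g ℕ.+_) (trans (ℕ.*-suc v k) (ℕ.+-comm v _))) (sym (ℕ.+-assoc g _ v))

-- A translation by 10j maps every coset to itself, so it rotates all of them by `j` at once.
cosetOf-transform : ∀ {α} → CW 60 (+ 36) α → ∀ σ j x →
                    cosetOf (λ g → σ * α (g ℕ.+ 10 ℕ.* j)) x ≡ transform (σ , j) (cosetOf α x)
cosetOf-transform {α} D σ j x = applyUpTo-cong 6 λ m → cong (λ z → σ * z) (trans (wrap m)
  (sym (nth-applyUpTo 0ℤ (λ m → α (x ℕ.+ 10 ℕ.* m)) 6 ((m ℕ.+ j) ℕ.% 6) (ℕ.m%n<n (m ℕ.+ j) 6))))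
  where
  index : ∀ x m j r q → m ℕ.+ j ≡ r ℕ.+ q ℕ.* 6 → x ℕ.+ 10 ℕ.* m ℕ.+ 10 ℕ.* j ≡ x ℕ.+ 10 ℕ.* r ℕ.+ 60 ℕ.* q
  index x m j r q eq = trans (regroup x m j) (trans (cong (λ i → x ℕ.+ 10 ℕ.* i) eq) (expand x r q))
    where
    regroup : ∀ x m j → x ℕ.+ 10 ℕ.* m ℕ.+ 10 ℕ.* j ≡ x ℕ.+ 10 ℕ.* (m ℕ.+ j)
    regroup = ℕ.solve-∀
    expand : ∀ x r q → x ℕ.+ 10 ℕ.* (r ℕ.+ q ℕ.* 6) ≡ x ℕ.+ 10 ℕ.* r ℕ.+ 60 ℕ.* q
    expand = ℕ.solve-∀

  wrap : ∀ m → α (x ℕ.+ 10 ℕ.* m ℕ.+ 10 ℕ.* j) ≡ α (x ℕ.+ 10 ℕ.* ((m ℕ.+ j) ℕ.% 6))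
  wrap m = trans (cong α (index x m j ((m ℕ.+ j) ℕ.% 6) ((m ℕ.+ j) ℕ./ 6) (ℕ.m≡m%n+[m/n]*n (m ℕ.+ j) 6)))
                 (periodic-* D ((m ℕ.+ j) ℕ./ 6) _)

record Normalised (i : ℕ) (α : ℕ → ℤ) : Set where
  field
    i<9  : i ℕ.< 9
    cw   : CW 60 (+ 36) α
    fits : ∀ x → x ℕ.< 10 → Fits (role i x) (cosetOf α x)

wholeCoset : ∀ {α} → CW 60 (+ 36) α → ∃[ α′ ] (CW 60 (+ 36) α′ × total (cosetOf α′ 0) ≢ 0ℤ)
wholeCoset {α} D =
  let x , _ , nonzero , _ = sum≢0⇒firstNonzero 10 (λ x → square (total (cosetOf α x)))
                              (λ eq → contradiction (trans (sym (Facts.sum-total² D)) eq) λ ())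
  in (λ g → α (g ℕ.+ x)) , shift D x , λ eq → nonzero (cong square (trans (cong total (same x)) eq))
  where
  same : ∀ x → cosetOf α x ≡ cosetOf (λ g → α (g ℕ.+ x)) 0
  same x = applyUpTo-cong 6 λ m → cong α (ℕ.+-comm x (10 ℕ.* m))

roleAfter-fits : ∀ i x (B : ℕ → List ℤ) → (∀ l → l ℕ.< i → Fits flat (B l)) → Fits leader (B i) →
                 Fits free (B x) → Fits (roleAfter i x) (B x)
roleAfter-fits zero    zero    B flats lead balanced = lead
roleAfter-fits zero    (suc x) B flats lead balanced = balanced
roleAfter-fits (suc i) zero    B flats lead balanced = flats 0 z<s
roleAfter-fits (suc i) (suc x) B flats lead balanced =
  roleAfter-fits i x (B ∘ suc) (λ l l<i → flats (suc l) (s<s l<i)) lead balanced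

module _ {α} (D : CW 60 (+ 36) α) (whole₀ : total (cosetOf α 0) ≢ 0ℤ) where

  open Facts D

  private
    whole-facts : square (total (coset 0)) ≡ + 36 × halvedNorm (coset 0) ≡ + 12
    whole-facts = All.lookup candidates-whole (coset∈candidates 0 z<s) whole₀

  -- The coset 0 already uses up the whole sum of squares 36.
  total≡0 : ∀ x → x ℕ.< 9 → total (coset (suc x)) ≡ 0ℤ
  total≡0 x x<9 = All.lookup candidates-total (coset∈candidates (suc x) (s<s x<9))
    (sum≡0⇒terms≡0 9 (λ x → square (total (coset (suc x))))
      (λ i i<9 → proj₂ (proj₂ (proj₂ (All.lookup candidates-nonneg (coset∈candidates (suc i) (s<s i<9))))))
      (trans (cancel rest) (cong (_- + 36) (trans (cong (_+ rest) (sym (proj₁ whole-facts)))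
        (trans (sym (sum-first 9 (λ x → square (total (coset x))))) sum-total²))))
      x x<9)
    where
    rest = sumTo 9 (λ x → square (total (coset (suc x))))
    cancel : ∀ s → s ≡ + 36 + s - + 36
    cancel = solve-∀

  -- The coset 0 supplies only 12 of the norm 36 of b, so a leader exists.
  sum-halvedNorm≢0 : sumTo 9 (λ x → halvedNorm (coset (suc x))) ≢ 0ℤ
  sum-halvedNorm≢0 eq = contradiction (trans (sym sum-halvedNorm)
    (trans (sum-first 9 (λ x → halvedNorm (coset x))) (cong₂ _+_ (proj₂ whole-facts) eq))) λ ()

  module _ {i σ j} (i<9 : i ℕ.< 9) (zeros : ∀ l → l ℕ.< i → halvedNorm (coset (suc l)) ≡ 0ℤ)
           (s∈ : (σ , j) ∈ symmetries) (normal : Normal (transform (σ , j) (coset (suc i)))) where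

    private
      A′ : ℕ → List ℤ
      A′ x = transform (σ , j) (coset x)

      transformed : ∀ x → x ℕ.< 10 → (total (A′ x) ≡ 0ℤ → total (coset x) ≡ 0ℤ) ×
                    (total (coset x) ≡ 0ℤ → total (A′ x) ≡ 0ℤ) ×
                    (halvedNorm (coset x) ≡ 0ℤ → halvedNorm (A′ x) ≡ 0ℤ)
      transformed x x<10 = All.lookup (All.lookup candidates-transform (coset∈candidates x x<10)) s∈

      transformed-total : ∀ x → x ℕ.< 9 → total (A′ (suc x)) ≡ 0ℤ
      transformed-total x x<9 = proj₁ (proj₂ (transformed (suc x) (s<s x<9))) (total≡0 x x<9)

      transformed-halvedNorm : ∀ l → l ℕ.< i → halvedNorm (A′ (suc l)) ≡ 0ℤ
      transformed-halvedNorm l l<i =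
        proj₂ (proj₂ (transformed (suc l) (s<s (ℕ.<-trans l<i i<9)))) (zeros l l<i)

      transformed-fits : ∀ x → x ℕ.< 10 → Fits (role i x) (A′ x)
      transformed-fits zero    _         = λ eq → whole₀ (proj₁ (transformed 0 z<s) eq)
      transformed-fits (suc x) (s<s x<9) = roleAfter-fits i x (A′ ∘ suc)
        (λ l l<i → transformed-total l (ℕ.<-trans l<i i<9) , transformed-halvedNorm l l<i)
        (transformed-total i i<9 , normal)
        (transformed-total x x<9)

    transform-normalised : Normalised i (λ g → σ * α (g ℕ.+ 10 ℕ.* j))
    transform-normalised = record
      { i<9  = i<9
      ; cw   = scale (proj₁ (∈-cartesianProduct⁻ (1ℤ ∷ -1ℤ ∷ []) (upTo 6) s∈)) (shift D (10 ℕ.* j))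
      ; fits = λ x x<10 → subst (Fits (role i x)) (sym (cosetOf-transform D σ j x)) (transformed-fits x x<10)
      }

  normalise : ∃[ i ] ∃[ α′ ] Normalised i α′
  normalise =
    let i , i<9 , nonzero , zeros = sum≢0⇒firstNonzero 9 (λ x → halvedNorm (coset (suc x))) sum-halvedNorm≢0
        _ , s∈ , normal           = find (All.lookup candidates-normal (coset∈candidates (suc i) (s<s i<9))
                                                     (total≡0 i i<9) nonzero)
    in i , _ , transform-normalised i<9 zeros s∈ normal

-- Characters

-- ζ has order 60 modulo the prime p.  Any modulus for which ζ⁶⁰ = 1 would be
-- sound, but a small one would let wrong choices pass the search by accident.
p ζ ζ⁻¹ : ℕ
p   = 1000000021
ζ   = 320560990
ζ⁻¹ = 18901455

-- The contribution of coset `x` to the character with g ↦ `t`.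
value : ℕ → ℕ → List ℤ → ℕ
value t x A = sumTo 6 (λ m → + (t ℕ.^ (x ℕ.+ 10 ℕ.* m)) * A ! m) %ℕ p

pos-^ : ∀ t n → + (t ℕ.^ n) ≡ (+ t) ^ n
pos-^ t zero    = refl
pos-^ t (suc n) = trans (pos-* t (t ℕ.^ n)) (cong (λ z → + t * z) (pos-^ t n))

foldBy-blocks : ∀ q r σ α → foldBy (q ℕ.* r) 1 σ α 0 ≡
                sumTo r (λ x → sumTo q (λ m → σ ^ (x ℕ.+ r ℕ.* m) * α (x ℕ.+ r ℕ.* m)))
foldBy-blocks q r σ α = trans (sum-cong (q ℕ.* r) λ i _ → cong (λ j → σ ^ i * α j) (ℕ.+-identityʳ i))
                              (sum-blocks q r (λ i → σ ^ i * α i))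

value-≈ : ∀ t α x → + value t x (cosetOf α x) ≈
          sumTo 6 (λ m → (+ t) ^ (x ℕ.+ 10 ℕ.* m) * α (x ℕ.+ 10 ℕ.* m)) [ + p ]
value-≈ t α x = ≈-trans (residue-≈ (sumTo 6 (λ m → + (t ℕ.^ (x ℕ.+ 10 ℕ.* m)) * α (x ℕ.+ 10 ℕ.* m))) p)
  (≈-reflexive (sum-cong 6 {λ m → + (t ℕ.^ (x ℕ.+ 10 ℕ.* m)) * α (x ℕ.+ 10 ℕ.* m)}
                           {λ m → (+ t) ^ (x ℕ.+ 10 ℕ.* m) * α (x ℕ.+ 10 ℕ.* m)}
    λ m _ → cong (_* α (x ℕ.+ 10 ℕ.* m)) (pos-^ t (x ℕ.+ 10 ℕ.* m))))

module _ {α} (D : CW 60 (+ 36) α) (t t⁻¹ : ℕ)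
         (inverse : + t * + t⁻¹ ≈ 1ℤ [ + p ]) (order : (+ t) ^ 60 ≈ 1ℤ [ + p ]) where

  private
    module χ = Projection D (+ p) 60 1 refl (+ t) (+ t⁻¹) inverse order

  character-sum : ∀ s → sumTo 10 (λ x → + value s x (cosetOf α x)) ≈ foldBy (6 ℕ.* 10) 1 (+ s) α 0 [ + p ]
  character-sum s = ≈-trans
    (sum-cong-≈ 10 {λ x → + value s x (cosetOf α x)}
                   {λ x → sumTo 6 (λ m → (+ s) ^ (x ℕ.+ 10 ℕ.* m) * α (x ℕ.+ 10 ℕ.* m))} λ x _ → value-≈ s α x)
    (≈-reflexive (sym (foldBy-blocks 6 10 (+ s) α)))

  character-norm : sumTo 10 (λ x → + value t x (cosetOf α x)) *
                   sumTo 10 (λ x → + value t⁻¹ x (cosetOf α x)) ≈ + 36 [ + p ]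
  character-norm = ≈-trans (*-cong-≈ (character-sum t) (character-sum t⁻¹))
    -- With `r = 1` the autocorrelation is a sum of one term, which `sumTo` writes as `0 +` that
    -- term.
    (≈-trans (≈-reflexive (sym (+-identityˡ (foldBy (6 ℕ.* 10) 1 (+ t) α 0 * foldBy (6 ℕ.* 10) 1 (+ t⁻¹) α 0))))
             (χ.autocorrelation 0 z<s))

RootsOfUnity : ℕ → Set
RootsOfUnity j = (+ (ζ ℕ.^ j) * + (ζ⁻¹ ℕ.^ j) ≈ 1ℤ [ + p ]) × ((+ (ζ ℕ.^ j)) ^ 60 ≈ 1ℤ [ + p ])

rootsOfUnity? : ∀ j → Dec (RootsOfUnity j)
rootsOfUnity? j = ≈-dec (+ (ζ ℕ.^ j) * + (ζ⁻¹ ℕ.^ j)) ×-dec ≈-dec ((+ (ζ ℕ.^ j)) ^ 60)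
  where
  ≈-dec : ∀ x → Dec (x ≈ 1ℤ [ + p ])
  ≈-dec x = map′ divisible difference (+ p ∣? (x - 1ℤ))

abstract
  rootsOfUnity₁ : RootsOfUnity 1
  rootsOfUnity₁ = toWitness {a? = rootsOfUnity? 1} _

  rootsOfUnity₂ : RootsOfUnity 2
  rootsOfUnity₂ = toWitness {a? = rootsOfUnity? 2} _

  rootsOfUnity₃ : RootsOfUnity 3
  rootsOfUnity₃ = toWitness {a? = rootsOfUnity? 3} _

-- Backtracking search

every : ∀ {A : Set} → (A → Bool) → List A → Bool
every f []       = true
every f (x ∷ xs) = if f x then every f xs else false

-- u and v are the contributions of an option to χ(D) and χ⁻¹(D) modulo p, and q is
-- collected for the final check.  Options are grouped by cost, so that groups
-- beyond the budget are discarded at once.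
data Option (Q : Set) : Set where
  option : (u v : ℕ) → Q → Option Q

Level : Set → Set
Level Q = List (ℕ × List (Option Q))

module Search {Q : Set} (budget : ℕ) (final : List Q → Bool) where

  -- The result `true` says that `final` holds for every complete choice of cost exactly `budget`
  -- whose two character sums have product 36 modulo `p`. Discarded branches count as `true`.
  search : List (Level Q) → ℕ → ℕ → ℕ → List Q → Bool
  tryGroup : List (Level Q) → ℕ → ℕ → ℕ → List Q → ℕ × List (Option Q) → Bool
  tryOption : List (Level Q) → ℕ → ℕ → ℕ → List Q → Option Q → Bool

  search [] a u v qs =
    if a ℕ.≡ᵇ budget then (if (u ℕ.* v) ℕ.% p ℕ.≡ᵇ 36 then final (reverse qs) else true) else true
  search (l ∷ ls) a u v qs = every (tryGroup ls a u v qs) l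
  tryGroup ls a u v qs (c , os) =
    if budget ℕ.<ᵇ a ℕ.+ c then true else every (tryOption ls (a ℕ.+ c) u v qs) os
  tryOption ls a u v qs (option u′ v′ q) = search ls a (u ℕ.+ u′) (v ℕ.+ v′) (q ∷ qs)

≡ᵇ-true : ∀ {m n} → m ≡ n → (m ℕ.≡ᵇ n) ≡ true
≡ᵇ-true {m} {n} eq = Equivalence.to Bool.T-≡ (ℕ.≡⇒≡ᵇ m n eq)

<ᵇ-false : ∀ {m n} → n ℕ.≤ m → (m ℕ.<ᵇ n) ≡ false
<ᵇ-false {m} {n} n≤m with m ℕ.<ᵇ n in eq
... | false = refl
... | true  = contradiction (ℕ.<ᵇ⇒< m n (subst T (sym eq) _)) (ℕ.≤⇒≯ n≤m)

does-true : ∀ {P : Set} (d : Dec P) → does d ≡ true → P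
does-true (yes p) _ = p

every-∈ : ∀ {A : Set} {f : A → Bool} {xs x} → every f xs ≡ true → x ∈ xs → f x ≡ true
every-∈ {f = f} {x ∷ xs} all x∈ with f x in eq
every-∈ {f = f} {x ∷ xs} all (here refl) | true = eq
every-∈ {f = f} {x ∷ xs} all (there x∈)  | true = every-∈ all x∈

-- Accumulates from the left so that it unfolds in step with the accumulators of `search`.
sumFrom : ℕ → (ℕ → ℕ) → ℕ → ℕ
sumFrom a f zero    = a
sumFrom a f (suc n) = sumFrom (a ℕ.+ f 0) (f ∘ suc) n

sumFrom-≥ : ∀ a f n → a ℕ.≤ sumFrom a f n
sumFrom-≥ a f zero    = ℕ.≤-refl
sumFrom-≥ a f (suc n) = ℕ.≤-trans (ℕ.m≤m+n a (f 0)) (sumFrom-≥ (a ℕ.+ f 0) (f ∘ suc) n)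

sumFrom-sum : ∀ a f n → + sumFrom a f n ≡ + a + sumTo n (λ i → + f i)
sumFrom-sum a f zero    = sym (+-identityʳ (+ a))
sumFrom-sum a f (suc n) = begin
  + sumFrom (a ℕ.+ f 0) (f ∘ suc) n               ≡⟨ sumFrom-sum (a ℕ.+ f 0) (f ∘ suc) n ⟩
  + a + + f 0 + sumTo n (λ i → + f (suc i))       ≡⟨ +-assoc (+ a) (+ f 0) (sumTo n (λ i → + f (suc i))) ⟩
  + a + (+ f 0 + sumTo n (λ i → + f (suc i)))     ≡⟨ cong (λ z → + a + z) (sum-first n (λ i → + f i)) ⟨
  + a + sumTo (suc n) (λ i → + f i)               ∎
  where open ≡-Reasoning

Chosen : ∀ {Q} → Level Q → ℕ → ℕ × ℕ → Q → Set
Chosen l c (u , v) q = ∃[ os ] ((c , os) ∈ l × option u v q ∈ os)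

module Soundness {Q : Set} (budget : ℕ) (final : List Q → Bool) where

  open Search budget final

  -- A choice that meets the budget and the norm follows a branch that is never pruned, so `final`
  -- was tested on it. For empty `qs` and concrete `n` the double reversal computes to
  -- `applyUpTo q n`.
  sound : ∀ n (L : ℕ → Level Q) c uv q → (∀ i → i ℕ.< n → Chosen (L i) (c i) (uv i) (q i)) →
          ∀ {a u v qs} → search (applyUpTo L n) a u v qs ≡ true →
          sumFrom a c n ≡ budget →
          (sumFrom u (proj₁ ∘ uv) n ℕ.* sumFrom v (proj₂ ∘ uv) n) ℕ.% p ≡ 36 →
          final (reverse (applyUpTo q n ʳ++ qs)) ≡ true
  sound zero    L c uv q chosen found cost norm rewrite ≡ᵇ-true cost | ≡ᵇ-true norm = found
  sound (suc n) L c uv q chosen {a} {u} {v} {qs} found cost norm with chosen 0 z<s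
  ... | os , os∈ , o∈ =
    sound n (L ∘ suc) (c ∘ suc) (uv ∘ suc) (q ∘ suc) (λ i i<n → chosen (suc i) (s<s i<n))
          (every-∈ {f = tryOption (applyUpTo (L ∘ suc) n) (a ℕ.+ c 0) u v qs} (affordable (every-∈ found os∈)) o∈) cost norm
    where
    affordable : tryGroup (applyUpTo (L ∘ suc) n) a u v qs (c 0 , os) ≡ true →
                 every (tryOption (applyUpTo (L ∘ suc) n) (a ℕ.+ c 0) u v qs) os ≡ true
    -- Costs are natural numbers, so a partial cost is bounded by the full cost, which is the
    -- budget.
    affordable h rewrite <ᵇ-false (subst (a ℕ.+ c 0 ℕ.≤_) cost (sumFrom-≥ (a ℕ.+ c 0) (c ∘ suc) n)) = h

-- Options for the cosets

group : ∀ {A K : Set} → DecidableEquality K → (A → K) → List A → List (K × List A)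
group _≟ₖ_ key xs = map (λ k → k , filter (λ x → key x ≟ₖ k) xs) (deduplicate _≟ₖ_ (map key xs))

record Entry : Set where
  constructor entry
  field
    word           : List ℤ
    at20 at30 at60 : ℕ × ℕ
    alternate      : ℤ
    cost30 cost60  : ℕ

open Entry

values : ℕ → ℕ → List ℤ → ℕ × ℕ
values j x A = value (ζ ℕ.^ j) x A , value (ζ⁻¹ ℕ.^ j) x A

mkEntry : ℕ → List ℤ → Entry
mkEntry x A =
  entry A (values 3 x A) (values 2 x A) (values 1 x A) (alternating A) ∣ halvedNorm A ∣ ∣ excess A ∣

-- Product.≡-dec would force the proofs of equality, which are unary in the numbers.
_≟²_ : DecidableEquality (ℕ × ℕ)
(u , v) ≟² (u′ , v′) = map′ (λ (p , q) → cong₂ _,_ p q) Product.,-injective ((u ℕ.≟ u′) ×-dec (v ℕ.≟ v′))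

level : ∀ {K : Set} → DecidableEquality K → (Entry → K) → (K → ℕ) → (Entry → ℕ × ℕ) → List Entry → Level K
level _≟ₖ_ key cost val es =
  map (λ (k , es′) → cost k , map (λ (u , v) → option u v k) (deduplicate _≟²_ (map val es′)))
      (group _≟ₖ_ key es)

-- Since ζ³⁰ ≡ -1 modulo `p`, the values at order 20 depend on the coset only through c; this makes
-- c a suitable key.
level20 : List Entry → Level ℤ
level20 = level _≟_ alternate (λ c → ∣ square c ∣) at20

level60 : List Entry → Level ℕ
level60 = level ℕ._≟_ cost60 id at60

-- Each option carries the level for order 60 built from the cosets it stands for, so a choice at
-- order 30 hands over the search space of the next stage.
level30 : List Entry → Level (Level ℕ)
level30 es =
  map (λ (k , es′) → k , map (λ ((u , v) , es″) → option u v (level60 es″)) (group _≟²_ at30 es′))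
      (group ℕ._≟_ cost30 es)

group-complete : ∀ {A K : Set} (_≟ₖ_ : DecidableEquality K) (key : A → K) {xs x} → x ∈ xs →
                 (key x , filter (λ y → key y ≟ₖ key x) xs) ∈ group _≟ₖ_ key xs ×
                 x ∈ filter (λ y → key y ≟ₖ key x) xs
group-complete _≟ₖ_ key {xs} x∈ =
  ∈-map⁺ (λ k → k , filter (λ y → key y ≟ₖ k) xs) (∈-deduplicate⁺ _≟ₖ_ (∈-map⁺ key x∈)) ,
  ∈-filter⁺ (λ y → key y ≟ₖ _) x∈ refl

level-complete : ∀ {K : Set} (_≟ₖ_ : DecidableEquality K) key cost val {es e} → e ∈ es →
                 Chosen (level _≟ₖ_ key cost val es) (cost (key e)) (val e) (key e)
level-complete _≟ₖ_ key cost val e∈ with group-complete _≟ₖ_ key e∈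
... | group∈ , e∈group = _ , ∈-map⁺ _ group∈ ,
  ∈-map⁺ (λ (u , v) → option u v _) (∈-deduplicate⁺ _≟²_ (∈-map⁺ val e∈group))

-- The filters are nested exactly as the two uses of `group` in `level30` nest them.
alike : Entry → List Entry → List Entry
alike e es = filter (λ e′ → at30 e′ ≟² at30 e) (filter (λ e′ → cost30 e′ ℕ.≟ cost30 e) es)

level30-complete : ∀ {es e} → e ∈ es →
                   Chosen (level30 es) (cost30 e) (at30 e) (level60 (alike e es)) × e ∈ alike e es
level30-complete {es} {e} e∈ with group-complete ℕ._≟_ cost30 e∈
... | group∈ , e∈group with group-complete _≟²_ at30 e∈group
...   | group∈′ , e∈group′ =
  (_ , ∈-map⁺ _ group∈ , ∈-map⁺ (λ ((u , v) , es″) → option u v (level60 es″)) group∈′) , e∈group′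

table : List (List ℤ) → List (List Entry)
table As = applyUpTo (λ x → map (mkEntry x) As) 10

-- The sequences c of norm 36 with c(0) = 0: either c = ±6 on a single coset,
-- which one being left open, or c is one of four sequences of ±2.
kinds : List (List (List ℤ))
kinds = replicate 10 (0ℤ ∷ + 6 ∷ - + 6 ∷ []) ∷
        map (λ c → map (_∷ []) (0ℤ ∷ c)) (c₁ ∷ map -_ c₁ ∷ c₂ ∷ map -_ c₂ ∷ [])
  where
  c₁ c₂ : List ℤ
  c₁ = + 2 ∷ + 2 ∷ - + 2 ∷ + 2 ∷ - + 2 ∷ - + 2 ∷ - + 2 ∷ - + 2 ∷ + 2 ∷ []
  c₂ = + 2 ∷ - + 2 ∷ - + 2 ∷ - + 2 ∷ - + 2 ∷ + 2 ∷ - + 2 ∷ + 2 ∷ + 2 ∷ []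

hasKind : List (List (List ℤ)) → List ℤ → Bool
hasKind κs cs = does (any? (λ κ → Pointwise.decidable _∈?_ cs κ) κs)

-- The three nested searches and the exclusion of all cases

module Search60 = Search {ℕ} 180 (λ _ → false)
module Search30 = Search {Level ℕ} 36 (λ ls → Search60.search ls 0 0 0 [])
module Search20 (κs : List (List (List ℤ))) = Search {ℤ} 36 (hasKind κs)

select : Role → List (List Entry) → ℕ → List Entry
select ρ tbl x = filter (λ e → fits? ρ (word e)) (nth [] tbl x)

allowed : List ℤ → List Entry → List Entry
allowed cs = filter (λ e → alternating (word e) ∈? cs)

-- Ignores the position of the leader, so that one search at order 20 serves all nine positions.
baseRole : ℕ → Role
baseRole zero    = whole
baseRole (suc _) = free

check20 : List (List (List ℤ)) → List (List Entry) → Bool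
check20 κs tbl = Search20.search κs (applyUpTo (λ x → level20 (select (baseRole x) tbl x)) 10) 0 0 0 []

check30 : List (List Entry) → List (List ℤ) → ℕ → Bool
check30 tbl κ i =
  Search30.search (applyUpTo (λ x → level30 (allowed (nth [] κ x) (select (role i x) tbl x))) 10) 0 0 0 []

check30All : List (List (List ℤ)) → List (List Entry) → Bool
check30All κs tbl = every (λ κ → every (check30 tbl κ) (upTo 9)) κs

-- With kinds and tbl abstract, conversion checking does not run the searches.
module Exclusion (kinds : List (List (List ℤ))) (tbl : List (List Entry))
             (tbl-complete : ∀ {x A} → x ℕ.< 10 → A ∈ candidates → mkEntry x A ∈ nth [] tbl x)
             (found20 : check20 kinds tbl ≡ true) (found30 : check30All kinds tbl ≡ true)
             {i α} (normalised : Normalised i α) where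

  open Normalised normalised
  open Facts cw

  e : ℕ → Entry
  e x = mkEntry x (coset x)

  e∈ : ∀ x → x ℕ.< 10 → e x ∈ nth [] tbl x
  e∈ x x<10 = tbl-complete x<10 (coset∈candidates x x<10)

  nonneg-cost : ∀ N (F : ℕ → ℤ) → (∀ x → x ℕ.< 10 → 0ℤ ≤ F x) → sumTo 10 F ≡ + N →
                sumFrom 0 (λ x → ∣ F x ∣) 10 ≡ N
  nonneg-cost N F F≥0 eq = +-injective (trans (sumFrom-sum 0 (λ x → ∣ F x ∣) 10)
    (trans (+-identityˡ (sumTo 10 (λ x → + ∣ F x ∣)))
    (trans (sum-cong 10 {λ x → + ∣ F x ∣} {F} (λ x x<10 → 0≤i⇒+∣i∣≡i (F≥0 x x<10))) eq)))

  norm-36 : ∀ j → RootsOfUnity j → (sumFrom 0 (λ x → proj₁ (values j x (coset x))) 10 ℕ.*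
                             sumFrom 0 (λ x → proj₂ (values j x (coset x))) 10) ℕ.% p ≡ 36
  norm-36 j (inverse , order) = ≈⇒% {b = 36}
    (≈-trans (≈-reflexive (trans (pos-* U V) (cong₂ _*_ (sum-of u) (sum-of v))))
             (character-norm cw (ζ ℕ.^ j) (ζ⁻¹ ℕ.^ j) inverse order))
    where
    u v : ℕ → ℕ
    u x = value (ζ ℕ.^ j) x (coset x)
    v x = value (ζ⁻¹ ℕ.^ j) x (coset x)
    U = sumFrom 0 u 10
    V = sumFrom 0 v 10
    sum-of : ∀ w → + sumFrom 0 w 10 ≡ sumTo 10 (λ x → + w x)
    sum-of w = trans (sumFrom-sum 0 w 10) (+-identityˡ (sumTo 10 (λ x → + w x)))

  base-fits : ∀ x → x ℕ.< 10 → Fits (baseRole x) (coset x)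
  base-fits zero    0<10 = fits 0 0<10
  base-fits (suc x) x<10 = weaken (roleAfter i x) (fits (suc x) x<10) (after i x)
    where
    after : ∀ i x → roleAfter i x ≢ whole
    after zero    zero    ()
    after zero    (suc x) ()
    after (suc i) zero    ()
    after (suc i) (suc x) eq = after i x eq
    weaken : ∀ ρ → Fits ρ (coset (suc x)) → ρ ≢ whole → total (coset (suc x)) ≡ 0ℤ
    weaken whole  _       ≢whole = contradiction refl ≢whole
    weaken flat   (t , _) _      = t
    weaken leader (t , _) _      = t
    weaken free   t       _      = t

  select∈ : ∀ ρ x → x ℕ.< 10 → Fits ρ (coset x) → e x ∈ select ρ tbl x
  select∈ ρ x x<10 = ∈-filter⁺ (λ e → fits? ρ (word e)) (e∈ x x<10)

  kind : ∃[ κ ] (κ ∈ kinds × Pointwise _∈_ (applyUpTo (λ x → alternating (coset x)) 10) κ)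
  kind = find (does-true (any? (λ κ → Pointwise.decidable _∈?_ (applyUpTo (λ x → alternating (coset x)) 10) κ) kinds)
    (Soundness.sound 36 (hasKind kinds) 10 (λ x → level20 (select (baseRole x) tbl x))
      (λ x → ∣ square (alternating (coset x)) ∣) (λ x → values 3 x (coset x)) (λ x → alternating (coset x))
      (λ x x<10 → level-complete _≟_ alternate (λ c → ∣ square c ∣) at20 (select∈ (baseRole x) x x<10 (base-fits x x<10)))
      {0} {0} {0} {[]} found20
      (nonneg-cost 36 (λ x → square (alternating (coset x)))
        (λ x x<10 → proj₁ (proj₂ (proj₂ (All.lookup candidates-nonneg (coset∈candidates x x<10))))) sum-alternating²)
      (norm-36 3 rootsOfUnity₃)))

  pointwise-nth : ∀ n {f : ℕ → ℤ} {κ} → Pointwise _∈_ (applyUpTo f n) κ → ∀ x → x ℕ.< n → f x ∈ nth [] κ x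
  pointwise-nth (suc n) (f0∈ ∷ _)  zero    _         = f0∈
  pointwise-nth (suc n) (_ ∷ rest) (suc x) (s<s x<n) = pointwise-nth n rest x x<n

  module _ {κ} (κ∈ : κ ∈ kinds) (alternating∈ : ∀ x → x ℕ.< 10 → alternating (coset x) ∈ nth [] κ x) where

    choices : ℕ → List Entry
    choices x = allowed (nth [] κ x) (select (role i x) tbl x)

    e∈choices : ∀ x → x ℕ.< 10 → e x ∈ choices x
    e∈choices x x<10 = ∈-filter⁺ (λ e → alternating (word e) ∈? nth [] κ x)
                                 (select∈ (role i x) x x<10 (fits x x<10)) (alternating∈ x x<10)

    found60 : Search60.search (applyUpTo (λ x → level60 (alike (e x) (choices x))) 10) 0 0 0 [] ≡ true
    found60 = Soundness.sound 36 (λ ls → Search60.search ls 0 0 0 []) 10 (λ x → level30 (choices x))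
      (λ x → ∣ halvedNorm (coset x) ∣) (λ x → values 2 x (coset x)) (λ x → level60 (alike (e x) (choices x)))
      (λ x x<10 → proj₁ (level30-complete (e∈choices x x<10)))
      {0} {0} {0} {[]}
      (every-∈ {f = check30 tbl κ} (every-∈ {f = λ κ → every (check30 tbl κ) (upTo 9)} found30 κ∈) (∈-upTo⁺ i<9))
      (nonneg-cost 36 (λ x → halvedNorm (coset x))
        (λ x x<10 → proj₁ (proj₂ (All.lookup candidates-nonneg (coset∈candidates x x<10)))) sum-halvedNorm)
      (norm-36 2 rootsOfUnity₂)

    -- The final test at order 60 is constantly false, so a search that succeeds has met no
    -- admissible choice; the cosets of D would be one.
    no-kind : false ≡ true
    no-kind = Soundness.sound 180 (λ _ → false) 10 (λ x → level60 (alike (e x) (choices x)))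
      (λ x → ∣ excess (coset x) ∣) (λ x → values 1 x (coset x)) (λ x → ∣ excess (coset x) ∣)
      (λ x x<10 → level-complete ℕ._≟_ cost60 id at60 (proj₂ (level30-complete (e∈choices x x<10))))
      {0} {0} {0} {[]} found60
      (nonneg-cost 180 (λ x → excess (coset x))
        (λ x x<10 → proj₁ (All.lookup candidates-nonneg (coset∈candidates x x<10))) sum-excess)
      (norm-36 1 rootsOfUnity₁)

  excluded : false ≡ true
  excluded = let κ , κ∈ , pw = kind in no-kind κ∈ (pointwise-nth 10 pw)

table-complete : ∀ {x A} → x ℕ.< 10 → A ∈ candidates → mkEntry x A ∈ nth [] (table candidates) x
table-complete {x} {A} x<10 A∈ =
  subst (mkEntry x A ∈_) (sym (nth-applyUpTo [] (λ x → map (mkEntry x) candidates) 10 x x<10)) (∈-map⁺ (mkEntry x) A∈)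

abstract
  found20 : check20 kinds (table candidates) ≡ true
  found20 = refl

  found30 : check30All kinds (table candidates) ≡ true
  found30 = refl

normalised⇒⊥ : ∀ {i α} → ¬ Normalised i α
normalised⇒⊥ N = contradiction (Exclusion.excluded kinds (table candidates) table-complete found20 found30 N) λ ()

mainTheorem18 : ¬ CWExists 60 36
mainTheorem18 (a , isCW) =
  let α , D , whole₀ = wholeCoset (fromIsCW isCW)
      _ , _ , N      = normalise D whole₀
  in normalised⇒⊥ N
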